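{- A graph $G$ is omnitonal if and only if, for every integer $r$ with $0\le r\le e(G)$, $G$ has both a partition $V(G)=X\cup Y$ and a set of vertices $W\subseteq V(G)$ such that $e(X,Y)=e(G[W])=r$.
   Context: Graphs are finite and simple; $e(G)=|E(G)|$; for a partition $V(G)=X\cup Y$ (disjoint parts, possibly empty), $e(X,Y)$ is the number of edges with one end in $X$ and the other in $Y$; $G[W]$ is the subgraph induced by $W$ ($W$ may be empty). A $2$-coloring $E(K_n)=E(R)\cup E(B)$ is a partition of the edges of $K_n$ into red edges (forming $R$) and blue edges (forming $B$). An $(r,b)$-colored copy of $G$ (with $r+b=e(G)$) is a (not necessarily induced) subgraph of $K_n$ isomorphic to $G$ with exactly $r$ red and $b$ blue edges. ${\rm ot}(n,G)$ is the minimum non-negative integer $s$ such that every $2$-coloring $E(K_n)=E(R)\cup E(B)$ with $\min\{e(R),e(B)\}>s$ contains an $(r,b)$-colored copy of $G$ for every pair of integers $r,b\ge0$ with $r+b=e(G)$. The graph $G$ is omnitonal if for every sufficiently large $n$ such an integer exists non-vacuously, that is, ${\rm ot}(n,G)<\lfloor\frac12\binom n2\rfloor$ (so that there are colorings with $\min\{e(R),e(B)\}>{\rm ot}(n,G)$). -}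

module Defs where

open import Data.Bool using (Bool; true; false; T; not; _∧_)
open import Data.Bool.Properties using (T?; ∧-comm)
open import Data.Empty using (⊥-elim)
open import Data.Fin using (Fin; _<?_; _≟_)
open import Data.Fin.Subset using (Subset; _∈_; _∪_; _∩_; ⊤; Empty)
open import Data.Fin.Subset.Properties using (_∈?_)
open import Data.List using (List; length; filter; allFin; cartesianProduct)
open import Data.Nat using (ℕ; _+_; _≤_; _<_; _⊓_; ⌊_/2⌋)
open import Data.Nat.Combinatorics using (_C_)
open import Data.Product using (∃-syntax; Σ-syntax; _×_; _,_)
open import Data.Sum using (_⊎_)
open import Function.Bundles using (_⇔_)
open import Function.Definitions using (Injective)
open import Relation.Binary.PropositionalEquality using (_≡_; _≢_; refl; sym; cong; cong₂)
open import Relation.Nullary using (¬_; Dec; does; yes; no)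
open import Relation.Nullary.Decidable using (_×-dec_; _⊎-dec_)

record Graph (n : ℕ) : Set where
  field
    adj        : Fin n → Fin n → Bool
    adj-sym    : ∀ u v → adj u v ≡ adj v u
    adj-irrefl : ∀ v → adj v v ≡ false

  Adj : Fin n → Fin n → Set
  Adj u v = T (adj u v)

open Graph public

-- Each edge is listed once, as the pair (u , v) with u < v.
edges : ∀ {n} → Graph n → List (Fin n × Fin n)
edges {n} G =
  filter (λ (u , v) → (u <? v) ×-dec T? (adj G u v))
         (cartesianProduct (allFin n) (allFin n))

e : ∀ {n} → Graph n → ℕ
e G = length (edges G)

K : ∀ n → Graph n
K n = record { adj = a ; adj-sym = a-sym ; adj-irrefl = a-irrefl }
  where
  a : Fin n → Fin n → Bool
  a u v = not (does (u ≟ v))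

  a-sym : ∀ u v → a u v ≡ a v u
  a-sym u v with u ≟ v | v ≟ u
  ... | yes _ | yes _ = refl
  ... | no _  | no _  = refl
  ... | yes p | no q  = ⊥-elim (q (sym p))
  ... | no p  | yes q = ⊥-elim (p (sym q))

  a-irrefl : ∀ v → a v v ≡ false
  a-irrefl v with v ≟ v
  ... | yes _ = refl
  ... | no p  = ⊥-elim (p refl)

-- `graph` carries the edge set of the subgraph; vertices outside `verts`
-- do not belong to the subgraph and are isolated in `graph`.
record Subgraph {n} (G : Graph n) : Set where
  field
    verts    : Subset n
    graph    : Graph n
    edge⊆    : ∀ {u v} → Adj graph u v → Adj G u v
    edge-end : ∀ {u v} → Adj graph u v → u ∈ verts × v ∈ verts

open Subgraph public

induced : ∀ {n} (G : Graph n) → Subset n → Subgraph G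
induced {n} G W = record
  { verts = W
  ; graph = record
      { adj        = λ u v → adj G u v ∧ within u v
      ; adj-sym    = λ u v → cong₂ _∧_ (adj-sym G u v)
                               (∧-comm (does (u ∈? W)) (does (v ∈? W)))
      ; adj-irrefl = λ v → cong (_∧ within v v) (adj-irrefl G v)
      }
  ; edge⊆    = λ {u} {v} → left (adj G u v)
  ; edge-end = λ {u} {v} → ends (adj G u v) (u ∈? W) (v ∈? W)
  }
  where
  within : Fin n → Fin n → Bool
  within u v = does (u ∈? W) ∧ does (v ∈? W)

  left : ∀ a {b} → T (a ∧ b) → T a
  left true _ = _

  ends : ∀ a {A B : Set} (p : Dec A) (q : Dec B) →
         T (a ∧ (does p ∧ does q)) → A × B
  ends true (yes x) (yes y) _ = x , y

IsPartition : ∀ {n} → Subset n → Subset n → Set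
IsPartition X Y = X ∪ Y ≡ ⊤ × Empty (X ∩ Y)

e-between : ∀ {n} → Graph n → Subset n → Subset n → ℕ
e-between G X Y =
  length (filter (λ (u , v) → ((u ∈? X) ×-dec (v ∈? Y)) ⊎-dec
                              ((u ∈? Y) ×-dec (v ∈? X)))
                 (edges G))

record _≅_ {m n} (G : Graph m) {F : Graph n} (H : Subgraph F) : Set where
  field
    to        : Fin m → Fin n
    injective : Injective _≡_ _≡_ to
    image     : ∀ v → v ∈ verts H ⇔ (∃[ u ] to u ≡ v)
    preserves : ∀ u v → adj G u v ≡ adj (graph H) (to u) (to v)

-- R and B need not be required to lie inside K n: this holds for every
-- graph on Fin n, by irreflexivity.
record Coloring (n : ℕ) : Set where
  field
    R B      : Graph n
    cover    : ∀ {u v} → Adj (K n) u v → Adj R u v ⊎ Adj B u v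
    disjoint : ∀ {u v} → ¬ (Adj R u v × Adj B u v)

open Coloring public

e-common : ∀ {n} → Graph n → Graph n → ℕ
e-common H F = length (filter (λ (u , v) → T? (adj F u v)) (edges H))

ColoredCopy : ∀ {m n} → Graph m → Coloring n → ℕ → ℕ → Set
ColoredCopy {n = n} G c r b =
  Σ[ H ∈ Subgraph (K n) ]
    G ≅ H × e-common (graph H) (R c) ≡ r × e-common (graph H) (B c) ≡ b

ForcesAllTones : ∀ {m} → ℕ → Graph m → ℕ → Set
ForcesAllTones n G s =
  (c : Coloring n) → s < e (R c) ⊓ e (B c) →
  ∀ r b → r + b ≡ e G → ColoredCopy G c r b

-- IsOt n G s says that s = ot(n, G).  Such an s always exists, since
-- ForcesAllTones n G is decidable and vacuously true of all large s.
IsOt : ∀ {m} → ℕ → Graph m → ℕ → Set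
IsOt n G s = ForcesAllTones n G s × (∀ t → ForcesAllTones n G t → s ≤ t)

Omnitonal : ∀ {m} → Graph m → Set
Omnitonal G =
  ∃[ N ] ∀ n → N ≤ n → ∃[ s ] IsOt n G s × s < ⌊ n C 2 /2⌋

{-# OPTIONS --safe #-}

-- For necessity, a coloring whose two colors have equally many edges contains all (r , b)-copies of G.  Such colorings
-- exist for infinitely many n with R a complete bipartite graph (n a square), where the red edges of a copy
-- of G form a cut of G, and with R a clique (n from a Pell equation), where they form an induced subgraph.
-- For sufficiency, let each color have about half of the edges and let n be large.  By double counting, each color
-- contains a large complete bipartite graph; Ramsey's theorem inside its sides yields either a pattern, that is, two
-- disjoint monochromatic cliques that are completely joined in one color, not all three colors being equal, or a large
-- clique of that color.  If both colors have a large clique, a Ramsey argument between these cliques gives a pattern.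
-- In a pattern, one of the colors forms a clique or a complete bipartite graph, and W or (X , Y) tells how to place G.
module Submission where

open import Data.Bool using (Bool; true; false; T; not; _∧_; _∨_; _xor_)
open import Data.Bool.Properties using (T?; ∧-assoc; ∧-comm; ∨-comm; ∨-idem; xor-comm; xor-same) renaming (_≟_ to _≟ᵇ_)
open import Data.Empty using (⊥-elim)
open import Data.Fin as Fin using (Fin; zero; suc; toℕ; fromℕ<; inject≤; _<?_; _≟_; combine; remQuot; finToFun; funToFin)
open import Data.Fin.Properties using (any?; all?; <-cmp; toℕ<n; toℕ-fromℕ<; inject≤-injective; remQuot-combine; finToFun-funToFin)
open import Data.Fin.Subset using (Subset; _∈_; ∁)
open import Data.Fin.Subset.Properties using (_∈?_; ∈⊤; x∈p∪q⁻; x∈p∩q⁺; x∈p∩q⁻; p∪∁p≡⊤; x∈p⇒x∉∁p; anySubset?)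
open import Data.List using (List; []; _∷_; _++_; length; lookup; map; filter; take; tabulate; allFin; cartesianProduct)
open import Data.List.Membership.Propositional.Properties using (∈-lookup)
open import Data.List.Properties using (filter-++; length-++; length-filter; length-take; map-tabulate)
open import Data.List.Relation.Binary.Sublist.Propositional using (_⊆_; []; _∷ʳ_; _∷_; minimum; ⊆-refl; ⊆-trans)
open import Data.List.Relation.Binary.Sublist.Propositional.Properties using (All-resp-⊆; filter-⊆)
open import Data.List.Relation.Unary.All as All using (All; []; _∷_)
import Data.List.Relation.Unary.All.Properties as All
open import Data.List.Relation.Unary.AllPairs as AllPairs using (AllPairs; []; _∷_)
import Data.List.Relation.Unary.AllPairs.Properties as AllPairs
open import Data.List.Relation.Unary.Unique.Propositional using (Unique)
open import Data.List.Relation.Unary.Unique.Propositional.Properties using (allFin⁺)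
open import Data.Nat using (ℕ; NonZero; ≢-nonZero⁻¹; zero; suc; _+_; _*_; _∸_; _^_; _⊓_; _⊔_; _≤_; _<_; _≤?_; _<ᵇ_; ⌊_/2⌋; ⌈_/2⌉; z≤n; s≤s)
open import Data.Nat.Combinatorics using (_C_; nC1≡n; nCk+nC[k+1]≡[n+1]C[k+1])
open import Data.Nat.Properties as ℕ hiding (_≟_; _≤?_; _<?_; <-cmp)
open import Data.Nat.Tactic.RingSolver using (solve-∀)
open import Algebra.Properties.Semiring.Sum +-*-semiring
open import Data.Product using (∃-syntax; _×_; _,_; proj₁; proj₂; uncurry)
open import Data.Sum using (_⊎_; inj₁; inj₂; [_,_]′)
open import Data.Unit using (tt)
import Data.Vec as Vec
open import Data.Vec.Properties using (lookup∘tabulate; []=⇒lookup; lookup⇒[]=)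
open import Function using (_∘_)
open import Function.Bundles using (_⇔_; mk⇔; Equivalence)
open import Function.Definitions using (Injective)
open import Level using (0ℓ)
open import Relation.Binary.Definitions using (Symmetric; tri<; tri≈; tri>)
open import Relation.Binary.PropositionalEquality using (_≡_; _≢_; _≗_; refl; sym; trans; cong; cong₂; subst; subst₂)
open import Relation.Nullary using (¬_; Dec; does; yes; no; contradiction)
open import Relation.Nullary.Decidable using (_×-dec_; _⊎-dec_; _→-dec_; ¬?; map′; dec-true; dec-false; does-⇔; decidable-stable)
open import Relation.Unary using (Pred; Decidable)
open import Defs

open ≤-Reasoning

-- Edge counts and copies of G

does⁻ : ∀ {a} {A : Set a} (d : Dec A) → T (does d) → A
does⁻ (yes x) _ = x

does⁺ : ∀ {a} {A : Set a} (d : Dec A) → A → T (does d)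
does⁺ (yes _) _ = tt
does⁺ (no ¬x) x = ¬x x

T⇒≡ : ∀ {b} → T b → b ≡ true
T⇒≡ {true} _ = refl

≡⇒T : ∀ {b} → b ≡ true → T b
≡⇒T refl = tt

¬T⇒≡ : ∀ {b} → ¬ T b → b ≡ false
¬T⇒≡ {true}  ¬t = ⊥-elim (¬t tt)
¬T⇒≡ {false} _  = refl

-- Edge counts are mostly handled doubled, through ordered pairs; this removes the factor two at the
-- end.
m+m≡n+n⇒m≡n : ∀ {m n} → m + m ≡ n + n → m ≡ n
m+m≡n+n⇒m≡n {m} {n} eq = trans (n≡⌊n+n/2⌋ m) (trans (cong ⌊_/2⌋ eq) (sym (n≡⌊n+n/2⌋ n)))

ι : Bool → ℕ
ι true  = 1
ι false = 0

ι-∧ : ∀ x y → ι (x ∧ y) ≡ ι x * ι y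
ι-∧ true  y = sym (+-identityʳ (ι y))
ι-∧ false _ = refl

-- Ordered pairs are counted because the condition `u < v` in `edges` is not preserved by vertex
-- maps. For a symmetric irreflexive relation the count is twice the number of edges.
pairs : ∀ {n} → (Fin n → Fin n → Bool) → ℕ
pairs {n} q = ∑[ u < n ] ∑[ v < n ] ι (q u v)

∑-cong₂ : ∀ {m n} {f g : Fin m → Fin n → ℕ} → (∀ i j → f i j ≡ g i j) →
          ∑[ i < m ] ∑[ j < n ] f i j ≡ ∑[ i < m ] ∑[ j < n ] g i j
∑-cong₂ f≗g = sum-cong-≗ λ i → sum-cong-≗ (f≗g i)

pairs-cong : ∀ {n} {p q : Fin n → Fin n → Bool} → (∀ u v → p u v ≡ q u v) → pairs p ≡ pairs q
pairs-cong p≗q = ∑-cong₂ λ u v → cong ι (p≗q u v)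

∑-distrib₂ : ∀ {m n} (f g : Fin m → Fin n → ℕ) →
             ∑[ i < m ] ∑[ j < n ] (f i j + g i j) ≡
             ∑[ i < m ] ∑[ j < n ] f i j + ∑[ i < m ] ∑[ j < n ] g i j
∑-distrib₂ {m} {n} f g = trans (sum-cong-≗ λ i → ∑-distrib-+ (f i) (g i)) (∑-distrib-+ {m} _ _)

pairs-+ : ∀ {n} {p q r : Fin n → Fin n → Bool} →
          (∀ u v → ι (p u v) + ι (q u v) ≡ ι (r u v)) → pairs p + pairs q ≡ pairs r
pairs-+ {n} {p} {q} split = trans (sym (∑-distrib₂ (λ u v → ι (p u v)) (λ u v → ι (q u v)))) (∑-cong₂ split)

∑-zero : ∀ {n} {f : Fin n → ℕ} → (∀ i → f i ≡ 0) → ∑[ i < n ] f i ≡ 0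
∑-zero {n} f≗0 = trans (sum-cong-≗ f≗0) (sum-replicate-zero n)

∑-one : ∀ n → ∑[ i < n ] 1 ≡ n
∑-one zero    = refl
∑-one (suc n) = cong suc (∑-one n)

∑-point : ∀ {n} (w : Fin n) (f : Fin n → ℕ) → ∑[ v < n ] (ι (does (w ≟ v)) * f v) ≡ f w
∑-point {suc n} zero f = begin-equality
  f zero + 0 + ∑[ v < n ] 0  ≡⟨ cong₂ _+_ (+-identityʳ (f zero)) (sum-replicate-zero n) ⟩
  f zero + 0                 ≡⟨ +-identityʳ (f zero) ⟩
  f zero                     ∎
∑-point (suc w) f = ∑-point w (f ∘ suc)

-- `q v` equals the sum of `q v` over the preimages of `v`: injectivity allows at most one, and
-- without one `q v` is zero. The two sums are then exchanged.
∑-image : ∀ {m n} (f : Fin m → Fin n) → Injective _≡_ _≡_ f → (q : Fin n → ℕ) →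
          (∀ v → (∃[ a ] f a ≡ v) ⊎ q v ≡ 0) →
          ∑[ v < n ] q v ≡ ∑[ a < m ] q (f a)
∑-image {m} {n} f inj q supp = begin-equality
  ∑[ v < n ] q v                                          ≡⟨ sum-cong-≗ fibre ⟩
  ∑[ v < n ] ∑[ a < m ] (ι (does (f a ≟ v)) * q v)        ≡⟨ ∑-comm {n} {m} _ ⟩
  ∑[ a < m ] ∑[ v < n ] (ι (does (f a ≟ v)) * q v)        ≡⟨ sum-cong-≗ (λ a → ∑-point (f a) q) ⟩
  ∑[ a < m ] q (f a)                                      ∎
  where
  fibre : ∀ v → q v ≡ ∑[ a < m ] (ι (does (f a ≟ v)) * q v)
  fibre v with supp v
  ... | inj₁ (a , refl) = begin-equality
    q (f a)                                            ≡⟨ ∑-point a (λ _ → q (f a)) ⟨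
    ∑[ b < m ] (ι (does (a ≟ b)) * q (f a))            ≡⟨ sum-cong-≗ (λ b → cong (λ x → ι x * q (f a))
                                                            (does-⇔ (mk⇔ (sym ∘ cong f) (sym ∘ inj)) (a ≟ b) (f b ≟ f a))) ⟩
    ∑[ b < m ] (ι (does (f b ≟ f a)) * q (f a))        ∎
  ... | inj₂ qv≡0 = trans qv≡0 (sym (∑-zero λ a → trans (cong (ι (does (f a ≟ v)) *_) qv≡0) (*-zeroʳ (ι (does (f a ≟ v))))))

length-filter-tabulate : ∀ {A : Set} {P : Pred A 0ℓ} (P? : Decidable P) {n} (f : Fin n → A) →
                         length (filter P? (tabulate f)) ≡ ∑[ i < n ] ι (does (P? (f i)))
length-filter-tabulate P? {zero}  f = refl
length-filter-tabulate P? {suc n} f with does (P? (f zero))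
... | true  = cong suc (length-filter-tabulate P? (f ∘ suc))
... | false = length-filter-tabulate P? (f ∘ suc)

length-filter-cartesianProduct :
  ∀ {A B : Set} {P : Pred (A × B) 0ℓ} (P? : Decidable P) {k n} (f : Fin k → A) (g : Fin n → B) →
  length (filter P? (cartesianProduct (tabulate f) (tabulate g))) ≡
  ∑[ i < k ] ∑[ j < n ] ι (does (P? (f i , g j)))
length-filter-cartesianProduct P? {zero}  f g = refl
length-filter-cartesianProduct P? {suc k} {n} f g = begin-equality
  length (filter P? (map (f zero ,_) (tabulate g) ++ rest))
    ≡⟨ cong length (filter-++ P? (map (f zero ,_) (tabulate g)) rest) ⟩
  length (filter P? (map (f zero ,_) (tabulate g)) ++ filter P? rest)
    ≡⟨ length-++ (filter P? (map (f zero ,_) (tabulate g))) ⟩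
  length (filter P? (map (f zero ,_) (tabulate g))) + length (filter P? rest)
    ≡⟨ cong (λ xs → length (filter P? xs) + length (filter P? rest)) (map-tabulate g (f zero ,_)) ⟩
  length (filter P? (tabulate λ j → f zero , g j)) + length (filter P? rest)
    ≡⟨ cong₂ _+_ (length-filter-tabulate P? (λ j → f zero , g j)) (length-filter-cartesianProduct P? (f ∘ suc) g) ⟩
  ∑[ j < n ] ι (does (P? (f zero , g j))) + ∑[ i < k ] ∑[ j < n ] ι (does (P? (f (suc i) , g j))) ∎
  where rest = cartesianProduct (tabulate (f ∘ suc)) (tabulate g)

length-filter-filter : ∀ {A : Set} {P Q : Pred A 0ℓ} (P? : Decidable P) (Q? : Decidable Q) xs →
  length (filter Q? (filter P? xs)) ≡ length (filter (λ x → P? x ×-dec Q? x) xs)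
length-filter-filter P? Q? [] = refl
length-filter-filter P? Q? (x ∷ xs) with does (P? x)
... | false = length-filter-filter P? Q? xs
... | true with does (Q? x)
...   | true  = cong suc (length-filter-filter P? Q? xs)
...   | false = length-filter-filter P? Q? xs

-- Transposing one copy of the sum exchanges `u` and `v`; by trichotomy each pair satisfying `q` is
-- then counted by exactly one copy.
pairs-< : ∀ {n} (q : Fin n → Fin n → Bool) → (∀ u v → q u v ≡ q v u) → (∀ u → q u u ≡ false) →
          let half = pairs λ u v → does (u <? v) ∧ q u v in half + half ≡ pairs q
pairs-< {n} q q-sym q-irrefl = begin-equality
  pairs below + pairs below                    ≡⟨ cong (pairs below +_) (∑-comm {n} {n} _) ⟩
  pairs below + pairs (λ u v → below v u)      ≡⟨ pairs-+ {p = below} {q = λ u v → below v u} {r = q} split ⟩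
  pairs q                                      ∎
  where
  below : Fin n → Fin n → Bool
  below u v = does (u <? v) ∧ q u v

  split : ∀ u v → ι (below u v) + ι (below v u) ≡ ι (q u v)
  split u v with <-cmp u v
  ... | tri< u<v _ v≮u rewrite dec-true (u <? v) u<v | dec-false (v <? u) v≮u = +-identityʳ _
  ... | tri> u≮v _ v<u rewrite dec-false (u <? v) u≮v | dec-true (v <? u) v<u = cong ι (q-sym v u)
  ... | tri≈ u≮u refl _ rewrite dec-false (u <? u) u≮u | q-irrefl u = refl

edges-filter : ∀ {n} (G : Graph n) {P : Pred (Fin n × Fin n) 0ℓ} (P? : Decidable P) →
               (∀ u v → does (P? (u , v)) ≡ does (P? (v , u))) →
               let c = length (filter P? (edges G)) in
               c + c ≡ pairs (λ u v → adj G u v ∧ does (P? (u , v)))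
edges-filter {n} G P? P-sym = begin-equality
  _ ≡⟨ cong (λ c → c + c) count ⟩
  _ ≡⟨ pairs-< (λ u v → adj G u v ∧ does (P? (u , v)))
         (λ u v → cong₂ _∧_ (adj-sym G u v) (P-sym u v))
         (λ u → cong (_∧ does (P? (u , u))) (adj-irrefl G u)) ⟩
  _ ∎
  where
  E? : Decidable (λ (p : Fin n × Fin n) → proj₁ p Fin.< proj₂ p × Adj G (proj₁ p) (proj₂ p))
  E? (u , v) = (u <? v) ×-dec T? (adj G u v)

  count : length (filter P? (edges G)) ≡ pairs (λ u v → does (u <? v) ∧ (adj G u v ∧ does (P? (u , v))))
  count = begin-equality
    length (filter P? (edges G))
      ≡⟨ length-filter-filter E? P? (cartesianProduct (tabulate (λ i → i)) (tabulate (λ i → i))) ⟩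
    _ ≡⟨ length-filter-cartesianProduct (λ x → E? x ×-dec P? x) (λ i → i) (λ i → i) ⟩
    pairs (λ u v → (does (u <? v) ∧ adj G u v) ∧ does (P? (u , v)))
      ≡⟨ pairs-cong (λ u v → ∧-assoc (does (u <? v)) (adj G u v) (does (P? (u , v)))) ⟩
    _ ∎

e+e≡pairs : ∀ {n} (G : Graph n) → e G + e G ≡ pairs (adj G)
e+e≡pairs {n} G = trans (cong (λ c → c + c) count) (pairs-< (adj G) (adj-sym G) (adj-irrefl G))
  where
  count : e G ≡ pairs (λ u v → does (u <? v) ∧ adj G u v)
  count = length-filter-cartesianProduct (λ ((u , v) : Fin n × Fin n) → (u <? v) ×-dec T? (adj G u v)) (λ i → i) (λ i → i)

e-common+e-common≡pairs : ∀ {n} (H F : Graph n) →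
  e-common H F + e-common H F ≡ pairs (λ u v → adj H u v ∧ adj F u v)
e-common+e-common≡pairs H F = edges-filter H (λ (u , v) → T? (adj F u v)) (adj-sym F)

-- Twice the number of edges of G that f maps to edges of F, since pairs are ordered.
tone : ∀ {m n} → Graph m → (Fin m → Fin n) → Graph n → ℕ
tone G f F = pairs λ a b → adj G a b ∧ adj F (f a) (f b)

-- All edges of `H` have their ends in the image of the embedding, so both sums over `Fin n` reduce
-- to sums over `Fin m`.
≅-tone : ∀ {m n} {G : Graph m} {K : Graph n} {H : Subgraph K} (i : G ≅ H) (F : Graph n) →
         e-common (graph H) F + e-common (graph H) F ≡ tone G (_≅_.to i) F
≅-tone {m} {n} {G} {K} {H} i F = begin-equality
  _                                            ≡⟨ e-common+e-common≡pairs (graph H) F ⟩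
  ∑[ u < n ] ∑[ v < n ] q u v                  ≡⟨ ∑-image to injective _ outer ⟩
  ∑[ a < m ] ∑[ v < n ] q (to a) v             ≡⟨ sum-cong-≗ (λ a → ∑-image to injective (q (to a)) (inner (to a))) ⟩
  ∑[ a < m ] ∑[ b < m ] q (to a) (to b)        ≡⟨ ∑-cong₂ (λ a b → cong (λ x → ι (x ∧ adj F (to a) (to b))) (sym (preserves a b))) ⟩
  tone G to F                                  ∎
  where
  open _≅_ i

  q : Fin n → Fin n → ℕ
  q u v = ι (adj (graph H) u v ∧ adj F u v)

  inner : ∀ u v → (∃[ a ] to a ≡ v) ⊎ q u v ≡ 0
  inner u v with T? (adj (graph H) u v)
  ... | yes uv = inj₁ (Equivalence.to (image v) (proj₂ (edge-end H uv)))
  ... | no ¬uv rewrite ¬T⇒≡ ¬uv = inj₂ refl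

  outer : ∀ u → (∃[ a ] to a ≡ u) ⊎ ∑[ v < n ] q u v ≡ 0
  outer u with any? (λ v → T? (adj (graph H) u v))
  ... | yes (v , uv) = inj₁ (Equivalence.to (image u) (proj₁ (edge-end H uv)))
  ... | no ¬uv       = inj₂ (∑-zero λ v → cong (λ x → ι (x ∧ adj F u v)) (¬T⇒≡ λ uv → ¬uv (v , uv)))

∈-tabulate⁺ : ∀ {n} (p : Fin n → Bool) {v} → T (p v) → v ∈ Vec.tabulate p
∈-tabulate⁺ p {v} pv = lookup⇒[]= v (Vec.tabulate p) (trans (lookup∘tabulate p v) (T⇒≡ pv))

∈-tabulate⁻ : ∀ {n} (p : Fin n → Bool) {v} → v ∈ Vec.tabulate p → T (p v)
∈-tabulate⁻ p {v} v∈ = ≡⇒T (trans (sym (lookup∘tabulate p v)) ([]=⇒lookup v∈))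

∈?-tabulate : ∀ {n} (p : Fin n → Bool) v → does (v ∈? Vec.tabulate p) ≡ p v
∈?-tabulate p v = does-⇔ (mk⇔ (∈-tabulate⁻ p) (∈-tabulate⁺ p)) (v ∈? Vec.tabulate p) (T? (p v))

≢⇒Adj-K : ∀ {n} {u v : Fin n} → u ≢ v → Adj (K n) u v
≢⇒Adj-K {u = u} {v} u≢v = ≡⇒T (cong not (dec-false (u ≟ v) u≢v))

Adj⇒≢ : ∀ {n} (F : Graph n) {u v} → Adj F u v → u ≢ v
Adj⇒≢ F {u} uv refl = subst T (adj-irrefl F u) uv

Adj-sym : ∀ {n} (F : Graph n) {u v} → Adj F u v → Adj F v u
Adj-sym F {u} {v} = subst T (adj-sym F u v)

module _ {m n} (G : Graph m) (f : Fin m → Fin n) (inj : Injective _≡_ _≡_ f) where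

  private
    Edge : Fin n → Fin n → Set
    Edge u v = ∃[ a ] ∃[ b ] f a ≡ u × f b ≡ v × Adj G a b

    edge? : ∀ u v → Dec (Edge u v)
    edge? u v = any? λ a → any? λ b → (f a ≟ u) ×-dec (f b ≟ v) ×-dec T? (adj G a b)

    flip-edge : ∀ {u v} → Edge u v → Edge v u
    flip-edge (a , b , p , q , ab) = b , a , q , p , Adj-sym G ab

    hit? : ∀ v → Dec (∃[ a ] f a ≡ v)
    hit? v = any? λ a → f a ≟ v

    Edge⇒≢ : ∀ {u v} → Edge u v → u ≢ v
    Edge⇒≢ (a , b , refl , fb≡fa , ab) refl = Adj⇒≢ G ab (inj (sym fb≡fa))

  imageSubgraph : Subgraph (K n)
  imageSubgraph = record
    { verts    = Vec.tabulate λ v → does (hit? v)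
    ; graph    = record
      { adj        = λ u v → does (edge? u v)
      ; adj-sym    = λ u v → does-⇔ (mk⇔ flip-edge flip-edge) (edge? u v) (edge? v u)
      ; adj-irrefl = λ v → dec-false (edge? v v) λ vv → Edge⇒≢ vv refl
      }
    ; edge⊆    = λ {u} {v} uv → ≢⇒Adj-K (Edge⇒≢ (does⁻ (edge? u v) uv))
    ; edge-end = λ {u} {v} uv → let a , b , p , q , _ = does⁻ (edge? u v) uv in
        ∈-tabulate⁺ _ (does⁺ (hit? u) (a , p)) , ∈-tabulate⁺ _ (does⁺ (hit? v) (b , q))
    }

  ≅-imageSubgraph : G ≅ imageSubgraph
  ≅-imageSubgraph = record
    { to        = f
    ; injective = inj
    ; image     = λ v → mk⇔ (does⁻ (hit? v) ∘ ∈-tabulate⁻ _) (∈-tabulate⁺ _ ∘ does⁺ (hit? v))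
    ; preserves = λ a b → does-⇔ (mk⇔ (λ ab → a , b , refl , refl , ab) (back a b)) (T? (adj G a b)) (edge? (f a) (f b))
    }
    where
    back : ∀ a b → Edge (f a) (f b) → Adj G a b
    back a b (a′ , b′ , p , q , ab) = subst₂ (Adj G) (inj p) (inj q) ab

R+B : ∀ {n} (c : Coloring n) {u v} → u ≢ v → ι (adj (R c) u v) + ι (adj (B c) u v) ≡ 1
R+B c {u} {v} u≢v with adj (R c) u v | adj (B c) u v | cover c {u} {v} (≢⇒Adj-K u≢v) | disjoint c {u} {v}
... | true  | true  | _       | d = ⊥-elim (d (tt , tt))
... | true  | false | _       | _ = refl
... | false | true  | _       | _ = refl
... | false | false | inj₁ () | _
... | false | false | inj₂ () | _

-- Injectivity sends every edge of `G` to a pair of distinct vertices, which has exactly one color.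
tone-R+B : ∀ {m n} (G : Graph m) (f : Fin m → Fin n) → Injective _≡_ _≡_ f → (c : Coloring n) →
           tone G f (R c) + tone G f (B c) ≡ e G + e G
tone-R+B G f inj c = trans (pairs-+ split) (sym (e+e≡pairs G))
  where
  split : ∀ a b → ι (adj G a b ∧ adj (R c) (f a) (f b)) + ι (adj G a b ∧ adj (B c) (f a) (f b)) ≡ ι (adj G a b)
  split a b with adj G a b in eq
  ... | false = refl
  ... | true  = R+B c (Adj⇒≢ G (≡⇒T eq) ∘ inj)

-- Only the red count has to be arranged: the two counts add up to `e G`, so the blue one follows.
copy⁺ : ∀ {m n} (G : Graph m) (c : Coloring n) {r b} → r + b ≡ e G →
        (f : Fin m → Fin n) → Injective _≡_ _≡_ f → tone G f (R c) ≡ r + r → ColoredCopy G c r b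
copy⁺ G c {r} {b} r+b f inj red =
  imageSubgraph G f inj , iso , m+m≡n+n⇒m≡n (trans (≅-tone iso (R c)) red)
                              , m+m≡n+n⇒m≡n (trans (≅-tone iso (B c)) blue)
  where
  iso = ≅-imageSubgraph G f inj

  blue : tone G f (B c) ≡ b + b
  blue = +-cancelˡ-≡ (tone G f (R c)) _ _ (begin-equality
    tone G f (R c) + tone G f (B c)  ≡⟨ tone-R+B G f inj c ⟩
    e G + e G                        ≡⟨ cong (λ x → x + x) r+b ⟨
    (r + b) + (r + b)                ≡⟨ rearrange r b ⟩
    (r + r) + (b + b)                ≡⟨ cong (_+ (b + b)) red ⟨
    tone G f (R c) + (b + b)         ∎)
    where
    rearrange : ∀ r b → (r + b) + (r + b) ≡ (r + r) + (b + b)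
    rearrange = solve-∀

copy⁻ : ∀ {m n} (G : Graph m) (c : Coloring n) {r b} → ColoredCopy G c r b →
        ∃[ f ] Injective _≡_ _≡_ f × tone {n = n} G f (R c) ≡ r + r
copy⁻ G c (H , iso , refl , _) = _≅_.to iso , _≅_.injective iso , sym (≅-tone iso (R c))

n+pairs-K : ∀ n → n + pairs (adj (K n)) ≡ n * n
n+pairs-K n = begin-equality
  n + pairs (adj (K n))
    ≡⟨ cong (_+ pairs (adj (K n))) (sym diagonal) ⟩
  pairs {n} (λ u v → does (u ≟ v)) + pairs (adj (K n))
    ≡⟨ pairs-+ {n} {p = λ u v → does (u ≟ v)} {r = λ _ _ → true} split ⟩
  ∑[ u < n ] ∑[ v < n ] 1
    ≡⟨ sum-cong-≗ {n} (λ u → trans (∑-one n) (sym (*-identityʳ n))) ⟩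
  ∑[ u < n ] (n * 1)
    ≡⟨ *-distribˡ-sum {n} n (λ _ → 1) ⟨
  n * (∑[ u < n ] 1)
    ≡⟨ cong (n *_) (∑-one n) ⟩
  n * n ∎
  where
  diagonal : pairs {n} (λ u v → does (u ≟ v)) ≡ n
  diagonal = trans
    (sum-cong-≗ {n} λ u → trans (sum-cong-≗ {n} λ v → sym (*-identityʳ (ι (does (u ≟ v))))) (∑-point u (λ _ → 1)))
    (∑-one n)

  split : ∀ (u v : Fin n) → ι (does (u ≟ v)) + ι (not (does (u ≟ v))) ≡ 1
  split u v with does (u ≟ v)
  ... | true  = refl
  ... | false = refl

-- Binomial counterpart of `n+pairs-K`; the term `n` on the left avoids truncated subtraction in
-- `n (n - 1)`.
n+nC2+nC2 : ∀ n → n + (n C 2 + n C 2) ≡ n * n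
n+nC2+nC2 zero    = refl
n+nC2+nC2 (suc n) = begin-equality
  suc n + (suc n C 2 + suc n C 2)                ≡⟨ cong (λ x → suc n + (x + x)) pascal ⟩
  suc n + ((n + n C 2) + (n + n C 2))            ≡⟨ shuffle n (n C 2) ⟩
  suc (n + n) + (n + (n C 2 + n C 2))            ≡⟨ cong (suc (n + n) +_) (n+nC2+nC2 n) ⟩
  suc (n + n) + n * n                            ≡⟨ square n ⟩
  suc n * suc n                                  ∎
  where
  pascal : suc n C 2 ≡ n + n C 2
  pascal = trans (sym (nCk+nC[k+1]≡[n+1]C[k+1] n 1)) (cong (_+ n C 2) (nC1≡n n))

  shuffle : ∀ n c → suc n + ((n + c) + (n + c)) ≡ suc (n + n) + (n + (c + c))
  shuffle = solve-∀

  square : ∀ n → suc (n + n) + n * n ≡ suc n * suc n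
  square = solve-∀

eR+eB : ∀ {n} (c : Coloring n) → e (R c) + e (B c) ≡ n C 2
eR+eB {n} c = m+m≡n+n⇒m≡n (+-cancelˡ-≡ n _ _ (begin-equality
  n + ((e (R c) + e (B c)) + (e (R c) + e (B c)))    ≡⟨ cong (n +_) (shuffle (e (R c)) (e (B c))) ⟩
  n + ((e (R c) + e (R c)) + (e (B c) + e (B c)))    ≡⟨ cong (n +_) (cong₂ _+_ (e+e≡pairs (R c)) (e+e≡pairs (B c))) ⟩
  n + (pairs (adj (R c)) + pairs (adj (B c)))        ≡⟨ cong (n +_) (pairs-+ split) ⟩
  n + pairs (adj (K n))                              ≡⟨ n+pairs-K n ⟩
  n * n                                              ≡⟨ n+nC2+nC2 n ⟨
  n + (n C 2 + n C 2)                                ∎))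
  where
  shuffle : ∀ x y → (x + y) + (x + y) ≡ (x + x) + (y + y)
  shuffle = solve-∀

  split : ∀ u v → ι (adj (R c) u v) + ι (adj (B c) u v) ≡ ι (adj (K n) u v)
  split u v with u ≟ v
  ... | yes refl = cong₂ (λ x y → ι x + ι y) (adj-irrefl (R c) u) (adj-irrefl (B c) u)
  ... | no u≢v   = R+B c u≢v

complement : ∀ {n} → Graph n → Graph n
complement {n} F = record
  { adj        = λ u v → adj (K n) u v ∧ not (adj F u v)
  ; adj-sym    = λ u v → cong₂ (λ x y → x ∧ not y) (adj-sym (K n) u v) (adj-sym F u v)
  ; adj-irrefl = λ v → cong (_∧ not (adj F v v)) (adj-irrefl (K n) v)
  }

coloring : ∀ {n} → Graph n → Coloring n
coloring F = record
  { R        = F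
  ; B        = complement F
  ; cover    = λ {u} {v} → covers (adj (K _) u v) (adj F u v)
  ; disjoint = λ {u} {v} → apart (adj (K _) u v) (adj F u v)
  }
  where
  covers : ∀ k x → T k → T x ⊎ T (k ∧ not x)
  covers true true  _ = inj₁ tt
  covers true false _ = inj₂ tt

  apart : ∀ k x → ¬ (T x × T (k ∧ not x))
  apart true  true (_ , ())
  apart false true (_ , ())

-- Balanced colorings without some tones

_∈ᵇ_ : ∀ {n} → Fin n → Subset n → Bool
v ∈ᵇ X = does (v ∈? X)

∁-partition : ∀ {n} (X : Subset n) → IsPartition X (∁ X)
∁-partition X = p∪∁p≡⊤ X , λ (v , v∈) → let v∈X , v∈∁X = x∈p∩q⁻ X (∁ X) v∈ in x∈p⇒x∉∁p v∈X v∈∁X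

partition-∈ᵇ : ∀ {n} {X Y : Subset n} → IsPartition X Y → ∀ v → v ∈ᵇ Y ≡ not (v ∈ᵇ X)
partition-∈ᵇ {X = X} {Y} (X∪Y , X∩Y) v = does-⇔ (mk⇔ out in′) (v ∈? Y) (¬? (v ∈? X))
  where
  out : v ∈ Y → ¬ v ∈ X
  out v∈Y v∈X = X∩Y (v , x∈p∩q⁺ (v∈X , v∈Y))

  in′ : ¬ v ∈ X → v ∈ Y
  in′ v∉X = [ (λ v∈X → contradiction v∈X v∉X) , (λ v∈Y → v∈Y) ]′ (x∈p∪q⁻ X Y (subst (v ∈_) (sym X∪Y) ∈⊤))

-- Membership in `Y` negates membership in `X`, so an edge crosses exactly when its ends differ in
-- membership of `X`. The `xor` form matches `cutGraph` and `blockColor-cut`.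
e-between-pairs : ∀ {n} (G : Graph n) {X Y : Subset n} → IsPartition X Y →
  e-between G X Y + e-between G X Y ≡ pairs λ u v → adj G u v ∧ ((u ∈ᵇ X) xor (v ∈ᵇ X))
e-between-pairs G {X} {Y} part = trans
  (edges-filter G (λ (u , v) → ((u ∈? X) ×-dec (v ∈? Y)) ⊎-dec ((u ∈? Y) ×-dec (v ∈? X))) crossing-sym)
  (pairs-cong λ u v → cong (adj G u v ∧_) (crossing u v))
  where
  crossing-sym : ∀ u v → (u ∈ᵇ X ∧ v ∈ᵇ Y) ∨ (u ∈ᵇ Y ∧ v ∈ᵇ X) ≡ (v ∈ᵇ X ∧ u ∈ᵇ Y) ∨ (v ∈ᵇ Y ∧ u ∈ᵇ X)
  crossing-sym u v = trans (∨-comm (u ∈ᵇ X ∧ v ∈ᵇ Y) _)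
    (cong₂ _∨_ (∧-comm (u ∈ᵇ Y) (v ∈ᵇ X)) (∧-comm (u ∈ᵇ X) (v ∈ᵇ Y)))

  xor-as-∨ : ∀ x y → (x ∧ not y) ∨ (not x ∧ y) ≡ x xor y
  xor-as-∨ true  true  = refl
  xor-as-∨ true  false = refl
  xor-as-∨ false y     = refl

  crossing : ∀ u v → (u ∈ᵇ X ∧ v ∈ᵇ Y) ∨ (u ∈ᵇ Y ∧ v ∈ᵇ X) ≡ (u ∈ᵇ X) xor (v ∈ᵇ X)
  crossing u v = trans
    (cong₂ (λ x y → (u ∈ᵇ X ∧ y) ∨ (x ∧ v ∈ᵇ X)) (partition-∈ᵇ part u) (partition-∈ᵇ part v))
    (xor-as-∨ (u ∈ᵇ X) (v ∈ᵇ X))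

∑-product : ∀ {m n} (f : Fin m → ℕ) (g : Fin n → ℕ) →
            ∑[ i < m ] ∑[ j < n ] (f i * g j) ≡ (∑[ i < m ] f i) * (∑[ j < n ] g j)
∑-product f g = trans (sum-cong-≗ λ i → sym (*-distribˡ-sum (f i) g)) (sym (*-distribʳ-sum (sum g) f))

∑-initial : ∀ {n} a → a ≤ n → ∑[ i < n ] ι (toℕ i <ᵇ a) ≡ a
∑-initial {n}     zero    _         = ∑-zero {n} λ _ → refl
∑-initial {suc n} (suc a) (s≤s a≤n) = cong suc (∑-initial a a≤n)

∑-not : ∀ {n} (σ : Fin n → Bool) → ∑[ i < n ] ι (σ i) + ∑[ i < n ] ι (not (σ i)) ≡ n
∑-not {n} σ = trans (sym (∑-distrib-+ (ι ∘ σ) (ι ∘ not ∘ σ))) (trans (sum-cong-≗ (λ i → one (σ i))) (∑-one n))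
  where
  one : ∀ x → ι x + ι (not x) ≡ 1
  one true  = refl
  one false = refl

cutGraph : ∀ {n} → (Fin n → Bool) → Graph n
cutGraph σ = record
  { adj        = λ u v → σ u xor σ v
  ; adj-sym    = λ u v → xor-comm (σ u) (σ v)
  ; adj-irrefl = λ v → xor-same (σ v)
  }

pairs-cutGraph : ∀ {n} (σ : Fin n → Bool) →
  let a = ∑[ i < n ] ι (σ i) ; b = ∑[ i < n ] ι (not (σ i)) in pairs (adj (cutGraph σ)) ≡ a * b + b * a
pairs-cutGraph {n} σ = begin-equality
  pairs (adj (cutGraph σ))
    ≡⟨ ∑-cong₂ (λ u v → ι-xor (σ u) (σ v)) ⟩
  ∑[ u < n ] ∑[ v < n ] (ι (σ u) * ι (not (σ v)) + ι (not (σ u)) * ι (σ v))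
    ≡⟨ ∑-distrib₂ {n} {n} _ _ ⟩
  _ ≡⟨ cong₂ _+_ (∑-product (ι ∘ σ) (ι ∘ not ∘ σ)) (∑-product (ι ∘ not ∘ σ) (ι ∘ σ)) ⟩
  _ ∎
  where
  ι-xor : ∀ x y → ι (x xor y) ≡ ι x * ι (not y) + ι (not x) * ι y
  ι-xor true  true  = refl
  ι-xor true  false = refl
  ι-xor false y     = sym (+-identityʳ (ι y))

cliqueGraph : ∀ {n} → (Fin n → Bool) → Graph n
cliqueGraph {n} σ = record
  { adj        = λ u v → adj (K n) u v ∧ (σ u ∧ σ v)
  ; adj-sym    = λ u v → cong₂ _∧_ (adj-sym (K n) u v) (∧-comm (σ u) (σ v))
  ; adj-irrefl = λ v → cong (_∧ (σ v ∧ σ v)) (adj-irrefl (K n) v)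
  }

-- The first term accounts for the diagonal pairs inside the clique; `∑-point` turns it into a
-- double sum.
pairs-cliqueGraph : ∀ {n} (σ : Fin n → Bool) →
  let a = ∑[ i < n ] ι (σ i) in a + pairs (adj (cliqueGraph σ)) ≡ a * a
pairs-cliqueGraph {n} σ = begin-equality
  ∑[ u < n ] ι (σ u) + pairs (adj (cliqueGraph σ))
    ≡⟨ cong (_+ pairs (adj (cliqueGraph σ))) (sum-cong-≗ λ u → sym (∑-point u (ι ∘ σ))) ⟩
  ∑[ u < n ] ∑[ v < n ] (ι (does (u ≟ v)) * ι (σ v)) + pairs (adj (cliqueGraph σ))
    ≡⟨ ∑-distrib₂ {n} {n} _ _ ⟨
  ∑[ u < n ] ∑[ v < n ] (ι (does (u ≟ v)) * ι (σ v) + ι (adj (cliqueGraph σ) u v))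
    ≡⟨ ∑-cong₂ split ⟩
  ∑[ u < n ] ∑[ v < n ] (ι (σ u) * ι (σ v))
    ≡⟨ ∑-product (ι ∘ σ) (ι ∘ σ) ⟩
  _ ∎
  where
  split : ∀ u v → ι (does (u ≟ v)) * ι (σ v) + ι (adj (cliqueGraph σ) u v) ≡ ι (σ u) * ι (σ v)
  split u v with u ≟ v
  ... | no _ = ι-∧ (σ u) (σ v)
  ... | yes refl with σ u
  ...   | true  = refl
  ...   | false = refl

-- Since `pairs (adj F)` is `2 * e F`, this says `4 * e F = n (n - 1)`: exactly half of all vertex
-- pairs are edges.
Balanced : ∀ {n} → Graph n → Set
Balanced {n} F = n + (pairs (adj F) + pairs (adj F)) ≡ n * n

balanced-min : ∀ {n} (F : Graph n) → Balanced F → e F ⊓ e (complement F) ≡ ⌊ n C 2 /2⌋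
balanced-min {n} F bal = begin-equality
  e F ⊓ e (complement F)  ≡⟨ cong (e F ⊓_) same ⟩
  e F ⊓ e F               ≡⟨ ⊓-idem (e F) ⟩
  e F                     ≡⟨ n≡⌊n+n/2⌋ (e F) ⟩
  ⌊ e F + e F /2⌋         ≡⟨ cong ⌊_/2⌋ half ⟩
  ⌊ n C 2 /2⌋             ∎
  where
  half : e F + e F ≡ n C 2
  half = m+m≡n+n⇒m≡n (+-cancelˡ-≡ n _ _ (begin-equality
    n + ((e F + e F) + (e F + e F))      ≡⟨ cong (λ x → n + (x + x)) (e+e≡pairs F) ⟩
    n + (pairs (adj F) + pairs (adj F))  ≡⟨ bal ⟩
    n * n                                ≡⟨ n+nC2+nC2 n ⟨
    n + (n C 2 + n C 2)                  ∎))

  same : e (complement F) ≡ e F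
  same = +-cancelˡ-≡ (e F) _ _ (trans (eR+eB (coloring F)) (sym half))

-- The sides have sizes `△ N` and `△ (suc N)`, consecutive triangular numbers. Their sum is the
-- square `n = (N + 1)²`, and their product `N (N + 1)² (N + 2) / 4` equals `n (n - 1) / 4`.
balanced-cut : ∀ N → ∃[ n ] N ≤ n × ∃[ σ ] Balanced {n} (cutGraph σ)
balanced-cut N = n , ≤-trans (n≤1+n N) (≤-trans (m≤m+n (suc N) x) (m≤n+m (suc N + x) x)) , σ , (begin-equality
  n + (pairs (adj (cutGraph σ)) + pairs (adj (cutGraph σ)))
    ≡⟨ cong (λ p → n + (p + p)) (pairs-cutGraph σ) ⟩
  n + ((a * b + b * a) + (a * b + b * a))
    ≡⟨ cong₂ (λ p q → n + ((p * q + q * p) + (p * q + q * p))) a≡x b≡ ⟩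
  n + ((x * (suc N + x) + (suc N + x) * x) + (x * (suc N + x) + (suc N + x) * x))
    ≡⟨ expand N x ⟩
  (x + x + suc N) + (x + x) * (suc N + suc N + (x + x))
    ≡⟨ cong (λ y → (y + suc N) + y * (suc N + suc N + y)) (2△ N) ⟩
  (N * suc N + suc N) + (N * suc N) * (suc N + suc N + (N * suc N))
    ≡⟨ square N ⟩
  (N * suc N + suc N) * (N * suc N + suc N)
    ≡⟨ cong (λ y → (y + suc N) * (y + suc N)) (2△ N) ⟨
  (x + x + suc N) * (x + x + suc N)
    ≡⟨ cong (λ y → y * y) (regroup N x) ⟩
  n * n ∎)
  where
  △ : ℕ → ℕ
  △ zero    = 0
  △ (suc k) = suc k + △ k

  2△ : ∀ k → △ k + △ k ≡ k * suc k
  2△ zero    = refl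
  2△ (suc k) = trans (shuffle k (△ k)) (trans (cong (suc k + suc k +_) (2△ k)) (next k))
    where
    shuffle : ∀ k t → (suc k + t) + (suc k + t) ≡ suc k + suc k + (t + t)
    shuffle = solve-∀
    next : ∀ k → suc k + suc k + k * suc k ≡ suc k * suc (suc k)
    next = solve-∀

  x n a b : ℕ
  x = △ N
  n = x + (suc N + x)

  σ : Fin n → Bool
  σ i = toℕ i <ᵇ x

  a = ∑[ i < n ] ι (σ i)
  b = ∑[ i < n ] ι (not (σ i))

  a≡x : a ≡ x
  a≡x = ∑-initial x (m≤m+n x (suc N + x))

  b≡ : b ≡ suc N + x
  b≡ = +-cancelˡ-≡ x _ _ (trans (cong (_+ b) (sym a≡x)) (∑-not σ))

  expand : ∀ N x → x + (suc N + x) + ((x * (suc N + x) + (suc N + x) * x) + (x * (suc N + x) + (suc N + x) * x))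
                 ≡ (x + x + suc N) + (x + x) * (suc N + suc N + (x + x))
  expand = solve-∀

  square : ∀ N → (N * suc N + suc N) + (N * suc N) * (suc N + suc N + (N * suc N))
               ≡ (N * suc N + suc N) * (N * suc N + suc N)
  square = solve-∀

  regroup : ∀ N x → x + x + suc N ≡ x + (suc N + x)
  regroup = solve-∀

-- Multiplication by 3 + 2√2 in the Pell equation (2n−1)² − 2(2a−1)² = −1, where n = 1 + p and a = 1 + q.
pell : ∀ N → ∃[ p ] ∃[ q ] N ≤ p × q ≤ p × 2 * (suc q * q) ≡ suc p * p
pell zero    = 0 , 0 , z≤n , z≤n , refl
pell (suc N) with pell N
... | p , q , N≤p , _ , eq =
  3 * p + 4 * q + 3 , 2 * p + 3 * q + 2 ,
  ≤-trans (s≤s N≤p) (subst (suc p ≤_) (big p q) (m≤m+n (suc p) _)) ,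
  subst (2 * p + 3 * q + 2 ≤_) (bigger p q) (m≤m+n _ (p + q + 1)) ,
  +-cancelˡ-≡ (suc p * p) _ _ (begin-equality
    suc p * p + 2 * (suc (2 * p + 3 * q + 2) * (2 * p + 3 * q + 2))  ≡⟨ step p q ⟩
    2 * (suc q * q) + suc (3 * p + 4 * q + 3) * (3 * p + 4 * q + 3)  ≡⟨ cong (_+ suc (3 * p + 4 * q + 3) * (3 * p + 4 * q + 3)) eq ⟩
    suc p * p + suc (3 * p + 4 * q + 3) * (3 * p + 4 * q + 3)        ∎)
  where
  big : ∀ p q → suc p + (2 * p + 4 * q + 2) ≡ 3 * p + 4 * q + 3
  big = solve-∀
  bigger : ∀ p q → 2 * p + 3 * q + 2 + (p + q + 1) ≡ 3 * p + 4 * q + 3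
  bigger = solve-∀
  step : ∀ p q → suc p * p + 2 * (suc (2 * p + 3 * q + 2) * (2 * p + 3 * q + 2)) ≡
                 2 * (suc q * q) + suc (3 * p + 4 * q + 3) * (3 * p + 4 * q + 3)
  step = solve-∀

-- A clique on `suc q` of `suc p` vertices has half of the edges exactly when
-- `2 (q + 1) q = (p + 1) p`, the equation solved by `pell`.
balanced-clique : ∀ N → ∃[ n ] N ≤ n × ∃[ σ ] Balanced {n} (cliqueGraph σ)
balanced-clique N with pell N
... | p , q , N≤p , q≤p , eq = suc p , ≤-trans N≤p (n≤1+n p) , σ , (begin-equality
  suc p + (c + c)         ≡⟨ cong (λ y → suc p + (y + y)) c≡ ⟩
  suc p + (suc q * q + suc q * q)  ≡⟨ cong (suc p +_) (double (suc q * q)) ⟩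
  suc p + 2 * (suc q * q) ≡⟨ cong (suc p +_) eq ⟩
  suc p + suc p * p       ≡⟨ *-suc (suc p) p ⟨
  suc p * suc p           ∎)
  where
  σ : Fin (suc p) → Bool
  σ i = toℕ i <ᵇ suc q

  c : ℕ
  c = pairs (adj (cliqueGraph σ))

  c≡ : c ≡ suc q * q
  c≡ = +-cancelˡ-≡ (suc q) _ _ (begin-equality
    suc q + c                              ≡⟨ cong (_+ c) (∑-initial (suc q) (s≤s q≤p)) ⟨
    (∑[ i < suc p ] ι (σ i)) + c           ≡⟨ pairs-cliqueGraph σ ⟩
    _                                      ≡⟨ cong (λ y → y * y) (∑-initial (suc q) (s≤s q≤p)) ⟩
    suc q * suc q                          ≡⟨ *-suc (suc q) q ⟩
    suc q + suc q * q                      ∎)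

  double : ∀ y → y + y ≡ 2 * y
  double = solve-∀

-- In a balanced coloring both colors have `⌊ n C 2 /2⌋` edges, which for large `n` exceeds the
-- threshold of an omnitonal graph.
omnitonal⇒tone : ∀ {m} {G : Graph m} → Omnitonal G → ∃[ N ] ∀ {n} → N ≤ n → (F : Graph n) → Balanced F →
  ∀ r → r ≤ e G → ∃[ f ] Injective _≡_ _≡_ f × tone G f F ≡ r + r
omnitonal⇒tone {G = G} (N , ot) = N , λ {n} N≤n F bal r r≤e →
  let s , (forces , _) , s< = ot n N≤n
  in copy⁻ G (coloring F) (forces (coloring F) (subst (s <_) (sym (balanced-min F bal)) s<) r (e G ∸ r) (m+[n∸m]≡n r≤e))

-- The embedding pulls the sides of a balanced cut back to a partition whose crossing edges are the
-- red edges of the copy.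
omnitonal⇒partition : ∀ {m} {G : Graph m} → Omnitonal G → ∀ r → r ≤ e G →
  ∃[ X ] ∃[ Y ] IsPartition X Y × e-between G X Y ≡ r
omnitonal⇒partition {G = G} om r r≤e =
  let N , tones           = omnitonal⇒tone om
      n , N≤n , σ , bal   = balanced-cut N
      f , inj , eq        = tones N≤n (cutGraph σ) bal r r≤e
      X                   = Vec.tabulate (σ ∘ f)
  in X , ∁ X , ∁-partition X , m+m≡n+n⇒m≡n (begin-equality
    e-between G X (∁ X) + e-between G X (∁ X)
      ≡⟨ e-between-pairs G (∁-partition X) ⟩
    pairs (λ u v → adj G u v ∧ ((u ∈ᵇ X) xor (v ∈ᵇ X)))
      ≡⟨ pairs-cong (λ u v → cong (adj G u v ∧_) (cong₂ _xor_ (∈?-tabulate (σ ∘ f) u) (∈?-tabulate (σ ∘ f) v))) ⟩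
    tone G f (cutGraph σ)
      ≡⟨ eq ⟩
    r + r ∎)

-- `W` is the preimage of a balanced clique, so its induced edges are the red edges of the copy.
omnitonal⇒induced : ∀ {m} {G : Graph m} → Omnitonal G → ∀ r → r ≤ e G → ∃[ W ] e (graph (induced G W)) ≡ r
omnitonal⇒induced {G = G} om r r≤e =
  let N , tones           = omnitonal⇒tone om
      n , N≤n , σ , bal   = balanced-clique N
      f , inj , eq        = tones N≤n (cliqueGraph σ) bal r r≤e
      W                   = Vec.tabulate (σ ∘ f)
  in W , m+m≡n+n⇒m≡n (begin-equality
    e (graph (induced G W)) + e (graph (induced G W))
      ≡⟨ e+e≡pairs (graph (induced G W)) ⟩
    pairs (λ u v → adj G u v ∧ ((u ∈ᵇ W) ∧ (v ∈ᵇ W)))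
      ≡⟨ pairs-cong (λ u v → cong (adj G u v ∧_) (cong₂ _∧_ (∈?-tabulate (σ ∘ f) u) (∈?-tabulate (σ ∘ f) v))) ⟩
    pairs (λ u v → adj G u v ∧ (σ (f u) ∧ σ (f v)))
      -- Adjacency in `cliqueGraph` also demands distinct vertices, which injectivity provides for
      -- the ends of an edge.
      ≡⟨ pairs-cong (λ u v → distinct f inj σ u v) ⟩
    tone G f (cliqueGraph σ)
      ≡⟨ eq ⟩
    r + r ∎)
  where
  distinct : ∀ {n} (f : Fin _ → Fin n) → Injective _≡_ _≡_ f → (σ : Fin n → Bool) → ∀ u v →
    adj G u v ∧ (σ (f u) ∧ σ (f v)) ≡ adj G u v ∧ (adj (K n) (f u) (f v) ∧ (σ (f u) ∧ σ (f v)))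
  distinct f inj σ u v with adj G u v in eq
  ... | false = refl
  ... | true  = cong (_∧ (σ (f u) ∧ σ (f v))) (sym (T⇒≡ (≢⇒Adj-K (Adj⇒≢ G (≡⇒T eq) ∘ inj))))

-- Decidability of ForcesAllTones

-- Upward search from zero. Recursion on the witness `k` ends it and yields `s ≤ k`, the bound that
-- later keeps the threshold below half of the edges.
least : ∀ {P : Pred ℕ 0ℓ} → Decidable P → ∀ k → P k → ∃[ s ] s ≤ k × P s × (∀ t → P t → s ≤ t)
least P? zero    p = zero , z≤n , p , λ _ _ → z≤n
least {P} P? (suc k) p with P? zero
... | yes p₀ = zero , z≤n , p₀ , λ _ _ → z≤n
... | no ¬p₀ with least (P? ∘ suc) k p
...   | s , s≤k , ps , min = suc s , s≤s s≤k , ps , min′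
  where
  min′ : ∀ t → P t → suc s ≤ t
  min′ zero    p₀ = contradiction p₀ ¬p₀
  min′ (suc t) pt = s≤s (min t pt)

_≈_ : ∀ {n} → Graph n → Graph n → Set
F ≈ F′ = ∀ u v → adj F u v ≡ adj F′ u v

e-cong : ∀ {n} (F F′ : Graph n) → F ≈ F′ → e F ≡ e F′
e-cong F F′ F≈F′ = m+m≡n+n⇒m≡n (trans (e+e≡pairs F) (trans (pairs-cong F≈F′) (sym (e+e≡pairs F′))))

-- Symmetrizing and deleting loops makes every subset of the `n * n` ordered pairs the code of a
-- graph.
decode : ∀ {n} → Subset (n * n) → Graph n
decode {n} S = record
  { adj        = λ u v → adj (K n) u v ∧ (Vec.lookup S (combine u v) ∨ Vec.lookup S (combine v u))
  ; adj-sym    = λ u v → cong₂ _∧_ (adj-sym (K n) u v) (∨-comm (Vec.lookup S (combine u v)) _)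
  ; adj-irrefl = λ v → cong (_∧ (Vec.lookup S (combine v v) ∨ Vec.lookup S (combine v v))) (adj-irrefl (K n) v)
  }

encode : ∀ {n} → Graph n → Subset (n * n)
encode {n} F = Vec.tabulate (uncurry (adj F) ∘ remQuot n)

decode-encode : ∀ {n} (F : Graph n) → decode (encode F) ≈ F
decode-encode {n} F u v = trans
  (cong (adj (K n) u v ∧_) (trans (cong₂ _∨_ (entry u v) (trans (entry v u) (adj-sym F v u))) (∨-idem (adj F u v))))
  loopless
  where
  entry : ∀ u v → Vec.lookup (encode F) (combine u v) ≡ adj F u v
  entry u v = trans (lookup∘tabulate _ (combine u v)) (cong (uncurry (adj F)) (remQuot-combine u v))

  loopless : adj (K n) u v ∧ adj F u v ≡ adj F u v
  loopless with u ≟ v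
  ... | yes refl = sym (adj-irrefl F u)
  ... | no _     = refl

-- The finitely many codes are searched. Decoding the code of `F` returns `F` only up to `≈`, which
-- is why `P` must respect `≈`.
allGraphs? : ∀ {n} {P : Pred (Graph n) 0ℓ} → Decidable P → (∀ F F′ → F ≈ F′ → P F → P F′) → Dec (∀ F → P F)
allGraphs? P? resp with anySubset? (¬? ∘ P? ∘ decode)
... | yes (S , ¬p) = no λ p → ¬p (p (decode S))
... | no ¬∃        = yes λ F → resp _ F (decode-encode F) (decidable-stable (P? _) λ ¬p → ¬∃ (encode F , ¬p))

HasTone : ∀ {m n} → Graph m → Graph n → ℕ → Set
HasTone G F r = ∃[ f ] Injective _≡_ _≡_ f × tone G f F ≡ r + r

tone-cong : ∀ {m n} (G : Graph m) {f g : Fin m → Fin n} (F F′ : Graph n) → f ≗ g → F ≈ F′ → tone G f F ≡ tone G g F′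
tone-cong G F F′ f≗g F≈F′ = pairs-cong λ a b →
  cong (adj G a b ∧_) (trans (cong₂ (adj F) (f≗g a) (f≗g b)) (F≈F′ _ _))

injective? : ∀ {m n} (f : Fin m → Fin n) → Dec (Injective _≡_ _≡_ f)
injective? f = map′ (λ inj {a} {b} → inj a b) (λ inj a b → inj)
                    (all? λ a → all? λ b → (f a ≟ f b) →-dec (a ≟ b))

-- Vertex maps are searched through their finite codes; a decoded map agrees pointwise with the
-- original, which preserves injectivity and tone.
hasTone? : ∀ {m n} (G : Graph m) (F : Graph n) → Decidable (HasTone G F)
hasTone? {m} {n} G F r = map′ (λ (k , p) → finToFun {n} {m} k , p) code
  (any? λ k → injective? (finToFun {n} {m} k) ×-dec (tone G (finToFun k) F ℕ.≟ r + r))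
  where
  code : HasTone G F r → ∃[ k ] Injective _≡_ _≡_ (finToFun {n} {m} k) × tone G (finToFun {n} {m} k) F ≡ r + r
  code (f , inj , eq) = funToFin f
    , (λ {a} {b} p → inj (trans (sym (same a)) (trans p (same b))))
    , trans (tone-cong G F F same (λ _ _ → refl)) eq
    where
    same : finToFun (funToFin f) ≗ f
    same = finToFun-funToFin f

-- Finitary form of `ForcesAllTones`: a coloring is represented by its red graph, and a pair
-- `(r , b)` by `r` alone.
Forced : ∀ {m n} → Graph m → ℕ → Graph n → Set
Forced G s F = s < e F ⊓ e (complement F) → ∀ (r : Fin (suc (e G))) → HasTone G F (toℕ r)

forced? : ∀ {m n} (G : Graph m) s → Decidable (Forced {n = n} G s)
forced? G s F = (s ℕ.<? e F ⊓ e (complement F)) →-dec all? λ r → hasTone? G F (toℕ r)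

forced-resp : ∀ {m n} (G : Graph m) s (F F′ : Graph n) → F ≈ F′ → Forced G s F → Forced G s F′
forced-resp {n = n} G s F F′ F≈F′ forced s< r =
  let f , inj , eq = forced (subst (s <_) (sym same-minimum) s<) r
  in f , inj , trans (sym (tone-cong G F F′ (λ _ → refl) F≈F′)) eq
  where
  same-minimum : e F ⊓ e (complement F) ≡ e F′ ⊓ e (complement F′)
  same-minimum = cong₂ _⊓_ (e-cong F F′ F≈F′)
    (e-cong (complement F) (complement F′) λ u v → cong (λ x → adj (K n) u v ∧ not x) (F≈F′ u v))

eB≡ : ∀ {n} (c : Coloring n) → e (B c) ≡ e (complement (R c))
eB≡ c = +-cancelˡ-≡ (e (R c)) _ _ (trans (eR+eB c) (sym (eR+eB (coloring (R c)))))

forces⇔forced : ∀ {m} n (G : Graph m) s → (∀ F → Forced {n = n} G s F) ⇔ ForcesAllTones n G s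
forces⇔forced n G s = mk⇔ forces forced
  where
  forces : (∀ F → Forced G s F) → ForcesAllTones n G s
  forces all c s< r b r+b =
    let f , inj , eq = all (R c) (subst (λ x → s < e (R c) ⊓ x) (eB≡ c) s<) (fromℕ< r<)
    in copy⁺ G c r+b f inj (subst (λ x → tone G f (R c) ≡ x + x) (toℕ-fromℕ< r<) eq)
    where
    r< : r < suc (e G)
    r< = s≤s (subst (r ≤_) r+b (m≤m+n r b))

  forced : ForcesAllTones n G s → ∀ F → Forced G s F
  forced all F s< r = copy⁻ G (coloring F) (all (coloring F) s< (toℕ r) (e G ∸ toℕ r) (m+[n∸m]≡n (≤-pred (toℕ<n r))))

forcesAllTones? : ∀ {m} n (G : Graph m) → Decidable (ForcesAllTones n G)
forcesAllTones? n G s = map′ to from (allGraphs? (forced? G s) (forced-resp G s))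
  where open Equivalence (forces⇔forced n G s)

isOt : ∀ {m} n (G : Graph m) {k} → ForcesAllTones n G k → ∃[ s ] s ≤ k × IsOt n G s
isOt n G = least (forcesAllTones? n G) _

-- Unavoidable patterns

AllPairs-resp-⊆ : ∀ {A : Set} {R : A → A → Set} {xs ys} → xs ⊆ ys → AllPairs R ys → AllPairs R xs
AllPairs-resp-⊆ []           []       = []
AllPairs-resp-⊆ (_ ∷ʳ τ)     (_ ∷ ps) = AllPairs-resp-⊆ τ ps
AllPairs-resp-⊆ (refl ∷ τ)   (p ∷ ps) = All-resp-⊆ τ p ∷ AllPairs-resp-⊆ τ ps

-- Pigeonhole with one unit of slack: if `a < k`, then `suc (a + b)` is at most `k + b`. The unit
-- allows for a vertex that belongs to neither of its own neighbourhoods.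
halve : ∀ {k a b} → k + k ≤ suc (a + b) → k ≤ a ⊎ k ≤ b
halve {k} {a} {b} 2k≤ with k ≤? a
... | yes k≤a = inj₁ k≤a
... | no k≰a  = inj₂ (+-cancelˡ-≤ k k b (≤-trans 2k≤ (+-monoˡ-≤ b (≰⇒> k≰a))))

2*-as-+ : ∀ k → 2 * k ≡ k + k
2*-as-+ k = cong (k +_) (+-identityʳ k)

module _ {n} (c : Coloring n) where

  color : Bool → Graph n
  color true  = R c
  color false = B c

  _-[_]-_ : Fin n → Bool → Fin n → Set
  u -[ κ ]- v = Adj (color κ) u v

  color-unique : ∀ κ κ′ {u v} → u -[ κ ]- v → u -[ κ′ ]- v → κ ≡ κ′
  color-unique true  true  _ _ = refl
  color-unique false false _ _ = refl
  color-unique true  false r b = ⊥-elim (disjoint c (r , b))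
  color-unique false true  b r = ⊥-elim (disjoint c (r , b))

  nbr? : ∀ κ u → Decidable (u -[ κ ]-_)
  nbr? κ u v = T? (adj (color κ) u v)

  nbrs : Bool → Fin n → List (Fin n) → List (Fin n)
  nbrs κ u = filter (nbr? κ u)

  nbrs-⊆ : ∀ κ u xs → nbrs κ u xs ⊆ xs
  nbrs-⊆ κ u = filter-⊆ (nbr? κ u)

  nbrs-adj : ∀ κ u xs → All (u -[ κ ]-_) (nbrs κ u xs)
  nbrs-adj κ u = All.all-filter (nbr? κ u)

  length-nbrs-∷ : ∀ κ u x xs → length (nbrs κ u (x ∷ xs)) ≡ ι (adj (color κ) u x) + length (nbrs κ u xs)
  length-nbrs-∷ κ u x xs with adj (color κ) u x
  ... | true  = refl
  ... | false = refl

  nbrs-split-∷ : ∀ u x xs → length (nbrs true u (x ∷ xs)) + length (nbrs false u (x ∷ xs)) ≡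
    (ι (adj (R c) u x) + ι (adj (B c) u x)) + (length (nbrs true u xs) + length (nbrs false u xs))
  nbrs-split-∷ u x xs = trans (cong₂ _+_ (length-nbrs-∷ true u x xs) (length-nbrs-∷ false u x xs))
    (shuffle (ι (adj (R c) u x)) (length (nbrs true u xs)) _ _)
    where
    shuffle : ∀ p a q b → (p + a) + (q + b) ≡ (p + q) + (a + b)
    shuffle = solve-∀

  nbrs-split : ∀ {u xs} → All (u ≢_) xs → length xs ≡ length (nbrs true u xs) + length (nbrs false u xs)
  nbrs-split []                       = refl
  nbrs-split {u} {x ∷ xs} (u≢x ∷ u≢xs) = sym (trans (nbrs-split-∷ u x xs)
    (cong₂ _+_ (R+B c u≢x) (sym (nbrs-split u≢xs))))

  -- Only `u` itself can be missed by both neighbourhoods, and it occurs at most once in `xs`.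
  nbrs-split-≤ : ∀ u {xs} → Unique xs → length xs ≤ suc (length (nbrs true u xs) + length (nbrs false u xs))
  nbrs-split-≤ u []       = z≤n
  nbrs-split-≤ u {x ∷ xs} (x≢xs ∷ xs!) with u ≟ x
  ... | yes refl = s≤s (subst (length xs ≤_) (sym (nbrs-split-∷ u u xs))
                     (≤-trans (≤-reflexive (nbrs-split x≢xs)) (m≤n+m _ (ι (adj (R c) u u) + ι (adj (B c) u u)))))
  ... | no u≢x   = s≤s (subst (length xs ≤_) (sym (trans (nbrs-split-∷ u x xs)
                       (cong (_+ (length (nbrs true u xs) + length (nbrs false u xs))) (R+B c u≢x))))
                     (nbrs-split-≤ u xs!))

  larger-nbrs : ∀ u {xs k} → Unique xs → 2 * k ≤ length xs → ∃[ κ ] k ≤ length (nbrs κ u xs)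
  larger-nbrs u {xs} {k} xs! 2k≤ = [ (true ,_) , (false ,_) ]′
    (halve (≤-trans (≤-reflexive (sym (2*-as-+ k))) (≤-trans 2k≤ (nbrs-split-≤ u xs!))))

  Homogeneous : List (Fin n) → Fin n → Set
  Homogeneous ys p = ∃[ κ ] All (p -[ κ ]-_) ys

  -- For each `p` in turn only the larger of its two color neighbourhoods is kept; every such
  -- halving costs a factor of two.
  homogenise : ∀ ps {xs k} → Unique xs → 2 ^ length ps * k ≤ length xs →
               ∃[ ys ] ys ⊆ xs × k ≤ length ys × All (Homogeneous ys) ps
  homogenise []       {xs} {k} xs! k≤ = xs , ⊆-refl , subst (_≤ length xs) (+-identityʳ k) k≤ , []
  homogenise (p ∷ ps) {xs} {k} xs! k≤ =
    let κ , half≤        = larger-nbrs p xs! (subst (_≤ length xs) (*-assoc 2 (2 ^ length ps) k) k≤)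
        zs               = nbrs κ p xs
        ys , τ , k≤ , hs = homogenise ps (AllPairs-resp-⊆ (nbrs-⊆ κ p xs) xs!) half≤
    in ys , ⊆-trans τ (nbrs-⊆ κ p xs) , k≤ , (κ , All-resp-⊆ τ (nbrs-adj κ p xs)) ∷ hs

  homogeneous-color : ∀ κ {p x ys} → p -[ κ ]- x → Homogeneous (x ∷ ys) p → All (p -[ κ ]-_) (x ∷ ys)
  homogeneous-color κ px (κ′ , px′ ∷ pys) with refl ← color-unique κ κ′ px px′ = px′ ∷ pys

  homogeneous-≢ : ∀ {p x ys} → Homogeneous (x ∷ ys) p → x ≢ p
  homogeneous-≢ (κ , px ∷ _) refl = Adj⇒≢ (color κ) px refl

  -- Each `p` sees all of `x ∷ ys` in one color, and its edge to the pivot `x` reveals which.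
  -- Selecting by that edge therefore selects a complete bipartite graph.
  nbrs-complete : ∀ κ {x ys ps} → All (Homogeneous (x ∷ ys)) ps →
                  All (λ p → All (p -[ κ ]-_) (x ∷ ys)) (nbrs κ x ps)
  nbrs-complete κ {x} {ys} {ps} hs = All.zipWith
    (λ (xp , h) → homogeneous-color κ (Adj-sym (color κ) xp) h)
    (nbrs-adj κ x ps , All-resp-⊆ (nbrs-⊆ κ x ps) hs)

  Clique : Bool → List (Fin n) → Set
  Clique κ = AllPairs _-[ κ ]-_

  Clique⇒Unique : ∀ κ {xs} → Clique κ xs → Unique xs
  Clique⇒Unique κ = AllPairs.map (Adj⇒≢ (color κ))

  CliqueIn : List (Fin n) → Bool → ℕ → Set
  CliqueIn xs κ k = ∃[ ps ] ps ⊆ xs × k ≤ length ps × Clique κ ps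

  extend-clique : ∀ κ v xs {k} → CliqueIn (nbrs κ v xs) κ k → CliqueIn (v ∷ xs) κ (suc k)
  extend-clique κ v xs (ps , τ , k≤ , ps!) =
    v ∷ ps , refl ∷ ⊆-trans τ (nbrs-⊆ κ v xs) , s≤s k≤ , All-resp-⊆ τ (nbrs-adj κ v xs) ∷ ps!

  widen-clique : ∀ κ κ′ v xs {k} → CliqueIn (nbrs κ v xs) κ′ k → CliqueIn (v ∷ xs) κ′ k
  widen-clique κ κ′ v xs (ps , τ , rest) = ps , v ∷ʳ ⊆-trans τ (nbrs-⊆ κ v xs) , rest

  -- One color neighbourhood of the first vertex is large enough for recursion. A clique found there
  -- either has the color of that neighbourhood and is extended by `v`, or is already as large as
  -- required.
  ramsey : ∀ a b {xs} → Unique xs → 2 ^ (a + b) ≤ length xs → CliqueIn xs true a ⊎ CliqueIn xs false b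
  ramsey zero    b       _ _ = inj₁ ([] , minimum _ , z≤n , [])
  ramsey (suc a) zero    _ _ = inj₂ ([] , minimum _ , z≤n , [])
  ramsey (suc a) (suc b) {[]} _ 2^≤0 = contradiction 2^≤0 (<⇒≱ (m^n>0 2 (suc a + suc b)))
  ramsey (suc a) (suc b) {v ∷ xs} (v≢xs ∷ xs!) 2^≤ = [ red , blue ]′ (halve bound)
    where
    -- The required length is twice that of either recursive call; the `suc` counts `v` itself.
    bound : 2 ^ (a + suc b) + 2 ^ (a + suc b) ≤ suc (length (nbrs true v xs) + length (nbrs false v xs))
    bound = ≤-trans (≤-reflexive (sym (2*-as-+ (2 ^ (a + suc b))))) (≤-trans 2^≤ (s≤s (≤-reflexive (nbrs-split v≢xs))))

    red : 2 ^ (a + suc b) ≤ length (nbrs true v xs) → CliqueIn (v ∷ xs) true (suc a) ⊎ CliqueIn (v ∷ xs) false (suc b)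
    red large = [ inj₁ ∘ extend-clique true v xs , inj₂ ∘ widen-clique true false v xs ]′
      (ramsey a (suc b) (AllPairs-resp-⊆ (nbrs-⊆ true v xs) xs!) large)

    blue : 2 ^ (a + suc b) ≤ length (nbrs false v xs) → CliqueIn (v ∷ xs) true (suc a) ⊎ CliqueIn (v ∷ xs) false (suc b)
    blue large = [ inj₁ ∘ widen-clique false true v xs , inj₂ ∘ extend-clique false v xs ]′
      (ramsey (suc a) b (AllPairs-resp-⊆ (nbrs-⊆ false v xs) xs!)
        (subst (λ i → 2 ^ i ≤ length (nbrs false v xs)) (+-suc a b) large))

  monochromatic : ∀ k {xs} → Unique xs → 2 ^ (k + k) ≤ length xs → ∃[ κ ] CliqueIn xs κ k
  monochromatic k xs! large = [ (true ,_) , (false ,_) ]′ (ramsey k k xs! large)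

  Complete : Bool → List (Fin n) → List (Fin n) → Set
  Complete κ ps ys = All (λ p → All (p -[ κ ]-_) ys) ps

  -- Disjointness of the two sides is implied by `between`, since no vertex is adjacent to itself.
  record Pattern (k : ℕ) : Set where
    field
      {left right}                : List (Fin n)
      {κ-left κ-right κ-between}  : Bool
      left-clique                 : Clique κ-left left
      right-clique                : Clique κ-right right
      between                     : Complete κ-between left right
      left-large                  : k ≤ length left
      right-large                 : k ≤ length right
      nonconstant                 : ¬ (κ-left ≡ κ-right × κ-right ≡ κ-between)

  record CompleteBipartite (κ : Bool) (k : ℕ) : Set where
    field
      {left right} : List (Fin n)
      left!        : Unique left
      right!       : Unique right
      complete     : Complete κ left right
      left-large   : k ≤ length left
      right-large  : k ≤ length right

  -- A clique on the left whose color differs from `κ` makes the pattern nonconstant, whatever the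
  -- color of the clique on the right.
  clique⊎pattern : ∀ {κ} k → CompleteBipartite κ (2 ^ (k + k)) → (∃[ ps ] k ≤ length ps × Clique κ ps) ⊎ Pattern k
  clique⊎pattern {κ} k bip = result (monochromatic k left! left-large)
    where
    open CompleteBipartite bip

    result : ∃[ κ′ ] CliqueIn left κ′ k → (∃[ ps ] k ≤ length ps × Clique κ ps) ⊎ Pattern k
    result (κ′ , ps , τ , k≤ps , ps!) with κ′ ≟ᵇ κ
    ... | yes refl = inj₁ (ps , k≤ps , ps!)
    ... | no κ′≢κ  =
      let κ″ , qs , υ , k≤qs , qs! = monochromatic k right! right-large
      in inj₂ record
        { κ-left       = κ′
        ; κ-right      = κ″
        ; κ-between    = κ
        ; left-clique  = ps!
        ; right-clique = qs!
        ; between      = All.map (All-resp-⊆ υ) (All-resp-⊆ τ complete)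
        ; left-large   = k≤ps
        ; right-large  = k≤qs
        ; nonconstant  = λ (p , q) → κ′≢κ (trans p q)
        }

  -- After `homogenise`, each of `k + k` red-clique vertices sees a common part of the blue clique
  -- in a single color. A pivot in that part splits them by color, and one class has at least `k`
  -- members. The sides are red and blue, so either class gives a nonconstant pattern.
  two-cliques⇒pattern : ∀ k .{{_ : NonZero k}} {ps qs} → Clique true ps → Clique false qs →
    k + k ≤ length ps → 2 ^ (k + k) * k ≤ length qs → Pattern k
  two-cliques⇒pattern k {ps} {qs} ps! qs! 2k≤ large = result
    (homogenise (take (k + k) ps) (Clique⇒Unique false qs!)
      (subst (λ i → 2 ^ i * k ≤ length qs) (sym length-rs) large))
    where
    rs : List (Fin n)
    rs = take (k + k) ps

    length-rs : length rs ≡ k + k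
    length-rs = trans (length-take (k + k) ps) (m≤n⇒m⊓n≡m 2k≤)

    result : ∃[ ys ] ys ⊆ qs × k ≤ length ys × All (Homogeneous ys) rs → Pattern k
    result ([] , _ , k≤0 , _) = contradiction (n≤0⇒n≡0 k≤0) (≢-nonZero⁻¹ k)
    result (x ∷ ys , τ , k≤ , hs) = [ pattern-of true , pattern-of false ]′ (halve
      (m≤n⇒m≤1+n (≤-reflexive (trans (sym length-rs) (nbrs-split (All.map homogeneous-≢ hs))))))
      where
      pattern-of : ∀ κ → k ≤ length (nbrs κ x rs) → Pattern k
      pattern-of κ k≤ps = record
        { κ-left       = true
        ; κ-right      = false
        ; κ-between    = κ
        ; left-clique  = AllPairs-resp-⊆ (nbrs-⊆ κ x rs) (AllPairs.take⁺ (k + k) ps!)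
        ; right-clique = AllPairs-resp-⊆ τ qs!
        ; between      = nbrs-complete κ hs
        ; left-large   = k≤ps
        ; right-large  = k≤
        ; nonconstant  = λ ()
        }

-- Complete bipartite subgraphs by double counting

∑-mono-≤ : ∀ {n} {f g : Fin n → ℕ} → (∀ i → f i ≤ g i) → ∑[ i < n ] f i ≤ ∑[ i < n ] g i
∑-mono-≤ {zero}  f≤g = z≤n
∑-mono-≤ {suc n} f≤g = +-mono-≤ (f≤g zero) (∑-mono-≤ (f≤g ∘ suc))

∑-const : ∀ n k → ∑[ i < n ] k ≡ n * k
∑-const zero    k = refl
∑-const (suc n) k = cong (k +_) (∑-const n k)

∑-affine : ∀ {n} m k (f : Fin n → ℕ) → ∑[ i < n ] (m * f i + k) ≡ m * (∑[ i < n ] f i) + n * k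
∑-affine {n} m k f = trans (∑-distrib-+ (λ i → m * f i) (λ _ → k)) (cong₂ _+_ (sym (*-distribˡ-sum m f)) (∑-const n k))

∑-ι≤ : ∀ {n} (p : Fin n → Bool) → ∑[ i < n ] ι (p i) ≤ n
∑-ι≤ {n} p = subst (∑[ i < n ] ι (p i) ≤_) (∑-one n) (∑-mono-≤ λ i → ι≤1 (p i))
  where
  ι≤1 : ∀ b → ι b ≤ 1
  ι≤1 true  = ≤-refl
  ι≤1 false = z≤n

-- The averaging principle behind `many-high` and `many-joined`: a large sum of bounded terms has
-- many terms above a threshold.
∑-threshold : ∀ {n} m k (f : Fin n → ℕ) {P : Pred (Fin n) 0ℓ} (large? : Decidable P) →
              (∀ i → f i ≤ m) → (∀ i → ¬ P i → f i ≤ k) →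
              ∑[ i < n ] f i ≤ m * length (filter large? (allFin n)) + n * k
∑-threshold {n} m k f large? f≤m f≤k = begin
  ∑[ i < n ] f i                                        ≤⟨ ∑-mono-≤ pointwise ⟩
  ∑[ i < n ] (m * ι (does (large? i)) + k)              ≡⟨ ∑-affine m k (λ i → ι (does (large? i))) ⟩
  m * (∑[ i < n ] ι (does (large? i))) + n * k          ≡⟨ cong (λ l → m * l + n * k) (length-filter-tabulate large? (λ i → i)) ⟨
  m * length (filter large? (allFin n)) + n * k         ∎
  where
  pointwise : ∀ i → f i ≤ m * ι (does (large? i)) + k
  pointwise i with large? i
  ... | yes _ = ≤-trans (f≤m i) (≤-trans (≤-reflexive (sym (*-identityʳ m))) (m≤m+n (m * 1) k))
  ... | no ¬l = ≤-trans (f≤k i ¬l) (m≤n+m k (m * 0))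

-- Rounding down costs at most one edge: `n C 2` is at most `2 * e F + 1`. Doubling this gives the
-- constant 2.
half-edges : ∀ {n} (F : Graph n) → ⌊ n C 2 /2⌋ ≤ e F → n * n ≤ n + (2 * pairs (adj F) + 2)
half-edges {n} F half≤ = begin
  n * n                               ≡⟨ n+nC2+nC2 n ⟨
  n + (n C 2 + n C 2)                 ≤⟨ +-monoʳ-≤ n (+-mono-≤ nC2≤ nC2≤) ⟩
  n + (suc (e F + e F) + suc (e F + e F))  ≡⟨ cong (λ p → n + (suc p + suc p)) (e+e≡pairs F) ⟩
  n + (suc p + suc p)                 ≡⟨ cong (n +_) (double p) ⟩
  n + (2 * p + 2)                     ∎
  where
  p : ℕ
  p = pairs (adj F)

  ⌈/2⌉≤ : ∀ k → ⌈ k /2⌉ ≤ suc ⌊ k /2⌋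
  ⌈/2⌉≤ zero          = z≤n
  ⌈/2⌉≤ (suc zero)    = s≤s z≤n
  ⌈/2⌉≤ (suc (suc k)) = s≤s (⌈/2⌉≤ k)

  nC2≤ : n C 2 ≤ suc (e F + e F)
  nC2≤ = begin
    n C 2                                  ≡⟨ ⌊n/2⌋+⌈n/2⌉≡n (n C 2) ⟨
    ⌊ n C 2 /2⌋ + ⌈ n C 2 /2⌉              ≤⟨ +-mono-≤ half≤ (≤-trans (⌈/2⌉≤ (n C 2)) (s≤s half≤)) ⟩
    e F + suc (e F)                        ≡⟨ +-suc (e F) (e F) ⟩
    suc (e F + e F)                        ∎

  double : ∀ p → suc p + suc p ≡ 2 * p + 2
  double = solve-∀

module _ {n} (c : Coloring n) (κ : Bool) where

  degree : Fin n → ℕ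
  degree v = ∑[ w < n ] ι (adj (color c κ) v w)

  High : Fin n → Set
  High v = n ≤ 4 * degree v

  high? : Decidable High
  high? v = n ≤? 4 * degree v

  -- The average degree is about `n / 2`, and vertices that are not `High` have degree below
  -- `n / 4`, so about a quarter of all vertices must be `High`.
  many-high : ∀ {k} → ⌊ n C 2 /2⌋ ≤ e (color c κ) → 4 * k ≤ n → k ≤ length (filter high? (allFin n))
  many-high {k} half≤ 4k≤n = ≮⇒≥ few
    where
    h p : ℕ
    h = length (filter high? (allFin n))
    p = pairs (adj (color c κ))

    degrees : 4 * p ≤ 4 * n * h + n * n
    degrees = begin
      4 * p                           ≡⟨ *-distribˡ-sum 4 degree ⟩
      ∑[ v < n ] (4 * degree v)       ≤⟨ ∑-threshold (4 * n) n (λ v → 4 * degree v) high?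
                                           (λ v → *-monoʳ-≤ 4 (∑-ι≤ (adj (color c κ) v)))
                                           (λ v → ≰⇒≥) ⟩
      4 * n * h + n * n               ∎

    few : ¬ h < k
    -- If `h < k`, then `4 (h + 1) ≤ n`, and the lower and upper bounds for `4 * p` would give
    -- `2 * n ≤ 4`, although `n ≥ 4`.
    few h<k = <⇒≱ 4<2n (+-cancelˡ-≤ (4 * n * h + n * n + 2 * n) (2 * n) 4 (begin
      4 * n * h + n * n + 2 * n + 2 * n        ≡⟨ regroup n h ⟩
      n * (4 * suc h) + n * n                  ≤⟨ +-monoˡ-≤ (n * n) (*-monoʳ-≤ n 4h+4≤n) ⟩
      n * n + n * n                            ≤⟨ +-mono-≤ (half-edges (color c κ) half≤) (half-edges (color c κ) half≤) ⟩
      (n + (2 * p + 2)) + (n + (2 * p + 2))    ≡⟨ collect n p ⟩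
      4 * p + (2 * n + 4)                      ≤⟨ +-monoˡ-≤ (2 * n + 4) degrees ⟩
      4 * n * h + n * n + (2 * n + 4)          ≡⟨ +-assoc (4 * n * h + n * n) (2 * n) 4 ⟨
      4 * n * h + n * n + 2 * n + 4            ∎))
      where
      4h+4≤n : 4 * suc h ≤ n
      4h+4≤n = ≤-trans (*-monoʳ-≤ 4 h<k) 4k≤n

      4<2n : 4 < 2 * n
      4<2n = ≤-trans (m≤m+n 5 3) (*-monoʳ-≤ 2 (≤-trans (*-monoʳ-≤ 4 (s≤s (z≤n {h}))) 4h+4≤n))

      regroup : ∀ n h → 4 * n * h + n * n + 2 * n + 2 * n ≡ n * (4 * suc h) + n * n
      regroup = solve-∀

      collect : ∀ n p → (n + (2 * p + 2)) + (n + (2 * p + 2)) ≡ 4 * p + (2 * n + 4)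
      collect = solve-∀

  codegree : List (Fin n) → Fin n → ℕ
  codegree ps x = length (nbrs c κ x ps)

  -- Edges between `ps` and all vertices are counted from both ends; each vertex of `ps` contributes
  -- at least `n / 4`.
  codegrees : ∀ {ps} → All High ps → length ps * n ≤ 4 * (∑[ x < n ] codegree ps x)
  codegrees []                 = z≤n
  codegrees {p ∷ ps} (hp ∷ hps) = begin
    n + length ps * n
      ≤⟨ +-mono-≤ hp (codegrees hps) ⟩
    4 * degree p + 4 * (∑[ x < n ] codegree ps x)
      ≡⟨ *-distribˡ-+ 4 (degree p) _ ⟨
    4 * (degree p + (∑[ x < n ] codegree ps x))
      ≡⟨ cong (4 *_) (∑-distrib-+ (λ x → ι (adj (color c κ) p x)) (codegree ps)) ⟨
    4 * (∑[ x < n ] (ι (adj (color c κ) p x) + codegree ps x))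
      ≡⟨ cong (4 *_) (sum-cong-≗ λ x → trans (cong (λ b → ι b + codegree ps x) (adj-sym (color c κ) p x))
                                              (sym (length-nbrs-∷ c κ x p ps))) ⟩
    4 * (∑[ x < n ] codegree (p ∷ ps) x) ∎
    where open ≤-Reasoning

  joined? : ∀ t ps → Decidable (λ x → t ≤ codegree ps x)
  joined? t ps x = t ≤? codegree ps x

  joined : ℕ → List (Fin n) → List (Fin n)
  joined t ps = filter (joined? t ps) (allFin n)

  -- The `8 * t` high vertices give an average codegree of at least `2 * t`. As codegrees never
  -- exceed `8 * t`, at least `n / 8` vertices reach the threshold `t`.
  many-joined : ∀ t .{{_ : NonZero t}} {ps} → All High ps → length ps ≡ 8 * t → n ≤ 8 * length (joined t ps)
  many-joined t {ps} hps len = *-cancelˡ-≤ t (*-cancelˡ-≤ 4 (+-cancelʳ-≤ (4 * (n * t)) _ _ (begin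
    4 * (t * n) + 4 * (n * t)            ≡⟨ regroup t n ⟩
    8 * t * n                            ≡⟨ cong (_* n) len ⟨
    length ps * n                        ≤⟨ codegrees hps ⟩
    4 * (∑[ x < n ] codegree ps x)       ≤⟨ *-monoʳ-≤ 4 (∑-threshold (8 * t) t (codegree ps) (joined? t ps) small (λ x → ≰⇒≥)) ⟩
    4 * (8 * t * j + n * t)              ≡⟨ distribute t j n ⟩
    4 * (t * (8 * j)) + 4 * (n * t)      ∎)))
    where
    j : ℕ
    j = length (joined t ps)

    small : ∀ x → codegree ps x ≤ 8 * t
    small x = ≤-trans (length-filter (nbr? c κ x) ps) (≤-reflexive len)

    regroup : ∀ t n → 4 * (t * n) + 4 * (n * t) ≡ 8 * t * n
    regroup = solve-∀

    distribute : ∀ t j n → 4 * (8 * t * j + n * t) ≡ 4 * (t * (8 * j)) + 4 * (n * t)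
    distribute = solve-∀

  -- The first size bound supplies `8 * t` high vertices, the second enough joined vertices to
  -- homogenise against them. The neighbours of a pivot among the high vertices form the left side.
  completeBipartite : ∀ t .{{_ : NonZero t}} → ⌊ n C 2 /2⌋ ≤ e (color c κ) →
    4 * (8 * t) ≤ n → 8 * (2 ^ (8 * t) * t) ≤ n → CompleteBipartite c κ t
  completeBipartite t half≤ 32t≤n large = result (homogenise c ps
      (AllPairs.filter⁺ (joined? t ps) (allFin⁺ n))
      (subst (λ i → 2 ^ i * t ≤ length (joined t ps)) (sym len)
        (*-cancelˡ-≤ 8 (≤-trans large (many-joined t hps len)))))
    where
    ps : List (Fin n)
    ps = take (8 * t) (filter high? (allFin n))

    len : length ps ≡ 8 * t
    len = trans (length-take (8 * t) _) (m≤n⇒m⊓n≡m (many-high half≤ 32t≤n))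

    hps : All High ps
    hps = All.take⁺ (8 * t) (All.all-filter high? (allFin n))

    ps! : Unique ps
    ps! = AllPairs.take⁺ (8 * t) (AllPairs.filter⁺ high? (allFin⁺ n))

    result : ∃[ ys ] ys ⊆ joined t ps × t ≤ length ys × All (Homogeneous c ys) ps → CompleteBipartite c κ t
    result ([] , _ , t≤0 , _) = contradiction (n≤0⇒n≡0 t≤0) (≢-nonZero⁻¹ t)
    result (x ∷ ys , τ , t≤ , hs) = record
      { left!       = AllPairs-resp-⊆ (nbrs-⊆ c κ x ps) ps!
      ; right!      = AllPairs-resp-⊆ τ (AllPairs.filter⁺ (joined? t ps) (allFin⁺ n))
      ; complete    = nbrs-complete c κ hs
      -- The pivot `x` is a joined vertex, so it has at least `t` neighbours of color `κ` in `ps`.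
      ; left-large  = All.head (All-resp-⊆ τ (All.all-filter (joined? t ps) (allFin n)))
      ; right-large = t≤
      }

shrink : ∀ {n} (c : Coloring n) {j k} → j ≤ k → Pattern c k → Pattern c j
shrink c j≤k P = record
  { left-clique  = left-clique
  ; right-clique = right-clique
  ; between      = between
  ; left-large   = ≤-trans j≤k left-large
  ; right-large  = ≤-trans j≤k right-large
  ; nonconstant  = nonconstant
  }
  where open Pattern P

unavoidable : ∀ k .{{_ : NonZero k}} → ∃[ N ] ∀ {n} → N ≤ n → (c : Coloring n) →
  ⌊ n C 2 /2⌋ ≤ e (R c) → ⌊ n C 2 /2⌋ ≤ e (B c) → Pattern c k
unavoidable k = 4 * (8 * t) + 8 * (2 ^ (8 * t) * t) , λ {n} N≤n c red blue →
  let bip : ∀ κ → ⌊ n C 2 /2⌋ ≤ e (color c κ) → CompleteBipartite c κ t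
      bip κ half≤ = completeBipartite c κ t half≤ (≤-trans (m≤m+n (4 * (8 * t)) _) N≤n)
                     (≤-trans (m≤n+m (8 * (2 ^ (8 * t) * t)) (4 * (8 * t))) N≤n)
  in from-colors c (clique⊎pattern c q (bip true red)) (clique⊎pattern c q (bip false blue))
  where
  q t : ℕ
  -- `q` covers both size bounds of `two-cliques⇒pattern`, and `t` is the Ramsey bound for cliques
  -- of size `q`.
  q = k + k + 2 ^ (k + k) * k
  t = 2 ^ (q + q)

  instance
    t≢0 : NonZero t
    t≢0 = m^n≢0 2 (q + q)

  k≤q : k ≤ q
  k≤q = ≤-trans (m≤m+n k k) (m≤m+n (k + k) _)

  from-colors : ∀ {n} (c : Coloring n) →
    (∃[ ps ] q ≤ length ps × Clique c true ps) ⊎ Pattern c q →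
    (∃[ ps ] q ≤ length ps × Clique c false ps) ⊎ Pattern c q → Pattern c k
  from-colors c (inj₂ P) _ = shrink c k≤q P
  from-colors c _ (inj₂ P) = shrink c k≤q P
  from-colors c (inj₁ (ps , q≤ps , ps!)) (inj₁ (qs , q≤qs , qs!)) = two-cliques⇒pattern c k ps! qs!
    (≤-trans (m≤m+n (k + k) _) q≤ps) (≤-trans (m≤n+m _ (k + k)) q≤qs)

-- Copies of G in a pattern

AllPairs-lookup : ∀ {A : Set} {R : A → A → Set} → Symmetric R → ∀ {xs} → AllPairs R xs →
                  ∀ i j → i ≢ j → R (lookup xs i) (lookup xs j)
AllPairs-lookup sym-R (p ∷ ps) zero    zero    i≢j = contradiction refl i≢j
AllPairs-lookup sym-R (p ∷ ps) zero    (suc j) _   = All.lookup p (∈-lookup j)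
AllPairs-lookup sym-R (p ∷ ps) (suc i) zero    _   = sym-R (All.lookup p (∈-lookup i))
AllPairs-lookup sym-R (p ∷ ps) (suc i) (suc j) i≢j = AllPairs-lookup sym-R ps i j (i≢j ∘ cong suc)

-- The last two arguments tell on which side each end lies, with `true` for the left.
blockColor : Bool → Bool → Bool → Bool → Bool → Bool
blockColor κ-left κ-right κ-between true  true  = κ-left
blockColor κ-left κ-right κ-between false false = κ-right
blockColor κ-left κ-right κ-between _     _     = κ-between

module _ {m n} (c : Coloring n) (P : Pattern c m) (τ : Fin m → Bool) where

  open Pattern P

  place : Bool → Fin m → Fin n
  place true  a = lookup left  (inject≤ a left-large)
  place false a = lookup right (inject≤ a right-large)

  embed : Fin m → Fin n
  embed a = place (τ a) a

  place-color : ∀ x y {a b} → a ≢ b → Adj (color c (blockColor κ-left κ-right κ-between x y)) (place x a) (place y b)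
  place-color true  true  a≢b = AllPairs-lookup (Adj-sym (color c κ-left)) left-clique _ _
                                  (a≢b ∘ inject≤-injective left-large left-large _ _)
  place-color false false a≢b = AllPairs-lookup (Adj-sym (color c κ-right)) right-clique _ _
                                  (a≢b ∘ inject≤-injective right-large right-large _ _)
  place-color true  false _   = All.lookup (All.lookup between (∈-lookup _)) (∈-lookup _)
  place-color false true  _   = Adj-sym (color c κ-between) (All.lookup (All.lookup between (∈-lookup _)) (∈-lookup _))

  pairColor : Fin m → Fin m → Bool
  pairColor a b = blockColor κ-left κ-right κ-between (τ a) (τ b)

  embed-color : ∀ {a b} → a ≢ b → Adj (color c (pairColor a b)) (embed a) (embed b)
  embed-color {a} {b} = place-color (τ a) (τ b)

  -- Distinct vertices have adjacent images, and adjacent vertices are distinct.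
  embed-injective : Injective _≡_ _≡_ embed
  embed-injective {a} {b} fa≡fb = decidable-stable (a ≟ b) λ a≢b →
    Adj⇒≢ (color c (pairColor a b)) (embed-color a≢b) fa≡fb

  embed-tone : ∀ (G : Graph m) κ → tone G embed (color c κ) ≡ pairs λ a b → adj G a b ∧ does (pairColor a b ≟ᵇ κ)
  embed-tone G κ = pairs-cong pointwise
    where
    pointwise : ∀ a b → adj G a b ∧ adj (color c κ) (embed a) (embed b) ≡ adj G a b ∧ does (pairColor a b ≟ᵇ κ)
    pointwise a b with adj G a b in eq
    ... | false = refl
    ... | true  = does-⇔ (mk⇔ (color-unique c (pairColor a b) κ colored)
                              (λ p → subst (λ κ → Adj (color c κ) (embed a) (embed b)) p colored))
                         (T? _) (pairColor a b ≟ᵇ κ)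
      where
      colored : Adj (color c (pairColor a b)) (embed a) (embed b)
      colored = embed-color (Adj⇒≢ G (≡⇒T eq))

blockColor-cut : ∀ {κ κ′} → κ ≢ κ′ → ∀ x y → does (blockColor κ κ κ′ x y ≟ᵇ κ′) ≡ x xor y
blockColor-cut {κ} {κ′} κ≢κ′ true  true  = dec-false (κ ≟ᵇ κ′) κ≢κ′
blockColor-cut {κ} {κ′} κ≢κ′ true  false = dec-true (κ′ ≟ᵇ κ′) refl
blockColor-cut {κ} {κ′} κ≢κ′ false true  = dec-true (κ′ ≟ᵇ κ′) refl
blockColor-cut {κ} {κ′} κ≢κ′ false false = dec-false (κ ≟ᵇ κ′) κ≢κ′

blockColor-left : ∀ {κ κ′} → κ ≢ κ′ → ∀ x y → does (blockColor κ κ′ κ′ x y ≟ᵇ κ) ≡ x ∧ y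
blockColor-left {κ} {κ′} κ≢κ′ true  true  = dec-true (κ ≟ᵇ κ) refl
blockColor-left {κ} {κ′} κ≢κ′ true  false = dec-false (κ′ ≟ᵇ κ) (κ≢κ′ ∘ sym)
blockColor-left {κ} {κ′} κ≢κ′ false true  = dec-false (κ′ ≟ᵇ κ) (κ≢κ′ ∘ sym)
blockColor-left {κ} {κ′} κ≢κ′ false false = dec-false (κ′ ≟ᵇ κ) (κ≢κ′ ∘ sym)

-- The labels are negated because the clique, labelled `true` by `x` and `y`, is to be placed on the
-- right.
blockColor-right : ∀ {κ κ′} → κ ≢ κ′ → ∀ x y → does (blockColor κ κ′ κ (not x) (not y) ≟ᵇ κ′) ≡ x ∧ y
blockColor-right {κ} {κ′} κ≢κ′ true  true  = dec-true (κ′ ≟ᵇ κ′) refl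
blockColor-right {κ} {κ′} κ≢κ′ true  false = dec-false (κ ≟ᵇ κ′) κ≢κ′
blockColor-right {κ} {κ′} κ≢κ′ false true  = dec-false (κ ≟ᵇ κ′) κ≢κ′
blockColor-right {κ} {κ′} κ≢κ′ false false = dec-false (κ ≟ᵇ κ′) κ≢κ′

Splittable : ∀ {m} → Graph m → Set
Splittable G = ∀ r → r ≤ e G →
  (∃[ X ] ∃[ Y ] IsPartition X Y × e-between G X Y ≡ r) × (∃[ W ] e (graph (induced G W)) ≡ r)

-- Exactly two of the three colors agree. The odd one forms a complete bipartite graph or a clique,
-- so a cut or an induced subgraph realizes its target. The pattern dictates which color this is,
-- hence a target for each.
chooseBlocks : ∀ {m} (G : Graph m) → Splittable G → (target : Bool → ℕ) → (∀ κ → target κ ≤ e G) →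
  ∀ κ-left κ-right κ-between → ¬ (κ-left ≡ κ-right × κ-right ≡ κ-between) →
  ∃[ κ ] ∃[ τ ] pairs (λ a b → adj G a b ∧ does (blockColor κ-left κ-right κ-between (τ a) (τ b) ≟ᵇ κ)) ≡
                  target κ + target κ
chooseBlocks G split target target≤ = choose
  where
  cut : ∀ r → r ≤ e G → ∃[ τ ] pairs (λ a b → adj G a b ∧ (τ a xor τ b)) ≡ r + r
  cut r r≤ =
    let X , Y , part , eq = proj₁ (split r r≤)
    in _∈ᵇ X , trans (sym (e-between-pairs G part)) (cong (λ k → k + k) eq)

  clique : ∀ r → r ≤ e G → ∃[ τ ] pairs (λ a b → adj G a b ∧ (τ a ∧ τ b)) ≡ r + r
  clique r r≤ =
    let W , eq = proj₂ (split r r≤)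
    in _∈ᵇ W , trans (sym (e+e≡pairs (graph (induced G W)))) (cong (λ k → k + k) eq)

  choose : ∀ κ-left κ-right κ-between → ¬ (κ-left ≡ κ-right × κ-right ≡ κ-between) →
    ∃[ κ ] ∃[ τ ] pairs (λ a b → adj G a b ∧ does (blockColor κ-left κ-right κ-between (τ a) (τ b) ≟ᵇ κ)) ≡
                    target κ + target κ
  choose κ₁ κ₂ κ₃ nonconstant with κ₁ ≟ᵇ κ₂ | κ₂ ≟ᵇ κ₃ | κ₁ ≟ᵇ κ₃
  ... | yes p    | yes q    | _        = contradiction (p , q) nonconstant
  ... | yes refl | no κ₁≢κ₃ | _        =
    let τ , eq = cut (target κ₃) (target≤ κ₃)
    in κ₃ , τ , trans (pairs-cong λ a b → cong (adj G a b ∧_) (blockColor-cut κ₁≢κ₃ (τ a) (τ b))) eq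
  ... | no κ₁≢κ₂ | yes refl | _        =
    let τ , eq = clique (target κ₁) (target≤ κ₁)
    in κ₁ , τ , trans (pairs-cong λ a b → cong (adj G a b ∧_) (blockColor-left κ₁≢κ₂ (τ a) (τ b))) eq
  ... | no κ₁≢κ₂ | no _     | yes refl =
    let τ , eq = clique (target κ₂) (target≤ κ₂)
    in κ₂ , not ∘ τ , trans (pairs-cong λ a b → cong (adj G a b ∧_) (blockColor-right κ₁≢κ₂ (τ a) (τ b))) eq
  -- Three Booleans cannot be pairwise distinct.
  choose true  true  _     _ | no p | no _ | no _ = contradiction refl p
  choose false false _     _ | no p | no _ | no _ = contradiction refl p
  choose _     true  true  _ | no _ | no p | no _ = contradiction refl p
  choose _     false false _ | no _ | no p | no _ = contradiction refl p
  choose true  _     true  _ | no _ | no _ | no p = contradiction refl p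
  choose false _     false _ | no _ | no _ | no p = contradiction refl p

pattern⇒copy : ∀ {m n} (G : Graph m) → Splittable G → (c : Coloring n) → Pattern c m →
               ∀ r b → r + b ≡ e G → ColoredCopy G c r b
pattern⇒copy G split c P r b r+b =
  let κ , τ , eq = chooseBlocks G split target target≤ κ-left κ-right κ-between nonconstant
      f          = embed c P τ
      inj        = λ {a} {b} → embed-injective c P τ {a} {b}
  in copy⁺ G c r+b f inj (red f inj κ (trans (embed-tone c P τ G κ) eq))
  where
  open Pattern P

  target : Bool → ℕ
  target true  = r
  target false = b

  target≤ : ∀ κ → target κ ≤ e G
  target≤ true  = subst (r ≤_) r+b (m≤m+n r b)
  target≤ false = subst (b ≤_) r+b (m≤n+m b r)

  red : ∀ f → Injective _≡_ _≡_ f → ∀ κ → tone G f (color c κ) ≡ target κ + target κ → tone G f (R c) ≡ r + r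
  red f inj true  eq = eq
  -- When the prescribed color is blue, the red count is what remains of `e G`.
  red f inj false eq = +-cancelʳ-≡ (b + b) _ _ (begin-equality
    tone G f (R c) + (b + b)         ≡⟨ cong (tone G f (R c) +_) eq ⟨
    tone G f (R c) + tone G f (B c)  ≡⟨ tone-R+B G f inj c ⟩
    e G + e G                        ≡⟨ cong (λ k → k + k) r+b ⟨
    (r + b) + (r + b)                ≡⟨ rearrange r b ⟩
    (r + r) + (b + b)                ∎)
    where
    rearrange : ∀ r b → (r + b) + (r + b) ≡ (r + r) + (b + b)
    rearrange = solve-∀

-- If `n C 2` were at most 1, then `n * n` would be at most `n + 2`, hence less than `3 * n`.
-- Positivity makes `∸ 1` a true predecessor in `threshold`.
half-positive : ∀ {n} → 3 ≤ n → 1 ≤ ⌊ n C 2 /2⌋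
half-positive {n} 3≤n = ⌊n/2⌋-mono {2} (≮⇒≥ λ nC2<2 → <⇒≱ (small nC2<2) (*-monoˡ-≤ n 3≤n))
  where
  small : n C 2 < 2 → n * n < 3 * n
  small nC2<2 = begin-strict
    n * n                 ≡⟨ n+nC2+nC2 n ⟨
    n + (n C 2 + n C 2)   ≤⟨ +-monoʳ-≤ n (+-mono-≤ (≤-pred nC2<2) (≤-pred nC2<2)) ⟩
    n + 2                 <⟨ +-monoʳ-< n (≤-trans 3≤n (m≤m+n n (n + 0))) ⟩
    3 * n                 ∎

-- The value `⌊ n C 2 /2⌋ ∸ 1` already forces all tones: colorings above it have at least
-- `⌊ n C 2 /2⌋` edges in each color, hence contain a pattern. The least forcing value is then below
-- half.
splittable⇒omnitonal : ∀ {m} (G : Graph m) → Splittable G → Omnitonal G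
splittable⇒omnitonal {m} G split =
  -- `unavoidable` requires a nonzero size and `m` may be zero; the pattern is shrunk to `m`
  -- afterwards.
  let N , pattern-at = unavoidable (suc m)
  in N ⊔ 3 , λ n N≤n → threshold n (pattern-at (≤-trans (m≤m⊔n N 3) N≤n)) (half-positive (≤-trans (m≤n⊔m N 3) N≤n))
  where
  threshold : ∀ n → (∀ c → ⌊ n C 2 /2⌋ ≤ e (R c) → ⌊ n C 2 /2⌋ ≤ e (B c) → Pattern c (suc m)) →
              1 ≤ ⌊ n C 2 /2⌋ → ∃[ s ] IsOt n G s × s < ⌊ n C 2 /2⌋
  threshold n pattern-at 1≤half =
    let s , s≤ , ot = isOt n G forces
    in s , ot , ≤-trans (s≤s s≤) (≤-reflexive suc-pred-half)
    where
    suc-pred-half : suc (⌊ n C 2 /2⌋ ∸ 1) ≡ ⌊ n C 2 /2⌋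
    suc-pred-half = m+[n∸m]≡n 1≤half

    forces : ForcesAllTones n G (⌊ n C 2 /2⌋ ∸ 1)
    forces c s< = pattern⇒copy G split c (shrink c (n≤1+n m) (pattern-at c
      (subst (_≤ e (R c)) suc-pred-half (m<n⊓o⇒m<n (e (R c)) (e (B c)) s<))
      (subst (_≤ e (B c)) suc-pred-half (m<n⊓o⇒m<o (e (R c)) (e (B c)) s<))))

theorem2p6 : ∀ (m : ℕ) (G : Graph m) →
    Omnitonal G ⇔
    (∀ (r : ℕ) → r ≤ e G →
    (∃[ X ] ∃[ Y ] IsPartition X Y × e-between G X Y ≡ r) ×
    (∃[ W ] e (graph (induced G W)) ≡ r))
theorem2p6 m G = mk⇔
  (λ om r r≤e → omnitonal⇒partition om r r≤e , omnitonal⇒induced om r r≤e)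
  (splittable⇒omnitonal G)
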